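{- There is an absolute constant $\gamma_0\ge 1$ such that for every constant $C>0$ there is a constant $K>0$ with the following property. For every integer $n\ge 2$ and every real $\gamma$ with $\gamma_0\le\gamma\le C\log^2 n$, there is a deterministic online algorithm for the online sorting problem that, on every input sequence of $n$ elements of $[0,1]$, inserts all elements into an array with at most $\gamma n$ cells and produces a solution of cost at most $K\,\frac{\log^2 n}{\gamma}$. In particular, there is a deterministic online algorithm that uses an array with $O(n\log^2 n)$ cells and has cost $O(1)$.
   Context: Logarithms are base $2$. Online sorting problem: a sequence of $n$ numbers (elements) in $[0,1]$ arrives one at a time, and an array with $m\ge n$ cells is given, where $n$ and $m$ are known in advance. When an element arrives, the algorithm must immediately and irrevocably place it in an empty cell of the array (each cell holds at most one element), without knowledge of future elements. It is assumed that the elements include a pair of sentinel values $0$ and $1$, which are present from the outset and occupy respectively the first and last cells of the array (so the optimal offline cost is $1$). After all elements have been inserted, the cost of the solution is the sum of $|x-y|$ over all pairs $x,y$ of elements occupying consecutive non-empty cells (that is, non-empty cells with no non-empty cell between them). -}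

module Defs where

open import Algebra.Bundles using (CommutativeRing)
open import Algebra.Structures using (IsCommutativeRing)
import Algebra.Properties.Ring as RingProperties
open import Data.Bool.Base using (if_then_else_)
open import Data.Fin.Base using (Fin; toℕ)
open import Data.List.Base using (List; []; _∷_; catMaybes; length)
open import Data.List.Relation.Unary.All using (All)
open import Data.Maybe.Base using (Maybe; just; nothing)
open import Data.Nat.Base as ℕ using (ℕ; zero; suc; z≤n; s≤s)
import Data.Nat.Properties as ℕₚ
open import Data.Product.Base using (∃; ∃-syntax; _×_; _,_; proj₁; proj₂)
open import Data.Sum.Base using (inj₁; inj₂)
open import Data.Vec.Base using (Vec; lookup; tabulate; toList; _[_]≔_)
open import Level using (0ℓ)
open import Relation.Binary.PropositionalEquality
open import Relation.Binary.Structures using (IsDecTotalOrder)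
import Relation.Binary.Construct.NonStrictToStrict as Strict
open import Relation.Nullary.Decidable using (does)

-- The standard library has no real numbers, so ℝ is given by its classical
-- axioms, those of a Dedekind-complete ordered field, which determine it up
-- to isomorphism. The order is decidable because algorithms may compare real
-- numbers.
record Reals : Set₁ where
  infix  8 _⁻¹ -_
  infixl 7 _*_
  infixl 6 _+_
  infix  4 _≤_
  field
    ℝ                 : Set
    _+_ _*_           : ℝ → ℝ → ℝ
    -_                : ℝ → ℝ
    0# 1#             : ℝ
    isCommutativeRing : IsCommutativeRing _≡_ _+_ _*_ -_ 0# 1#
    -- The value of 0# ⁻¹ is left unspecified.
    _⁻¹               : ℝ → ℝ
    0≢1               : 0# ≢ 1#
    ⁻¹-inverseʳ       : ∀ x → x ≢ 0# → x * x ⁻¹ ≡ 1#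
    _≤_               : ℝ → ℝ → Set
    isDecTotalOrder   : IsDecTotalOrder _≡_ _≤_
    +-monoˡ-≤         : ∀ z {x y} → x ≤ y → x + z ≤ y + z
    *-nonNegative     : ∀ {x y} → 0# ≤ x → 0# ≤ y → 0# ≤ x * y

  UpperBound : (ℝ → Set) → ℝ → Set
  UpperBound P b = ∀ x → P x → x ≤ b

  IsSupremum : (ℝ → Set) → ℝ → Set
  IsSupremum P s = UpperBound P s × (∀ b → UpperBound P b → s ≤ b)

  field
    complete : ∀ (P : ℝ → Set) → ∃ P → ∃ (UpperBound P) → ∃ (IsSupremum P)

  commutativeRing : CommutativeRing 0ℓ 0ℓ
  commutativeRing = record { isCommutativeRing = isCommutativeRing }

  open IsCommutativeRing isCommutativeRing public
    using ( +-assoc; +-comm; +-identityˡ; +-identityʳ; -‿inverseˡ; -‿inverseʳ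
          ; *-assoc; *-comm; *-identityˡ; *-identityʳ; distribˡ; distribʳ
          ; zeroˡ; zeroʳ )
  open IsDecTotalOrder isDecTotalOrder public
    using (_≟_; _≤?_)
    renaming (refl to ≤-refl; reflexive to ≤-reflexive; trans to ≤-trans;
              antisym to ≤-antisym; total to ≤-total)
  open Strict _≡_ _≤_ public using (_<_)

  infixl 7 _/_
  _/_ : ℝ → ℝ → ℝ
  x / y = x * y ⁻¹

  infixl 6 _-_
  _-_ : ℝ → ℝ → ℝ
  x - y = x + - y

  ∣_∣ : ℝ → ℝ
  ∣ x ∣ = if does (0# ≤? x) then x else - x

  fromℕ : ℕ → ℝ
  fromℕ zero    = 0#
  fromℕ (suc n) = 1# + fromℕ n

module Logarithm (R : Reals) where
  open Reals R

  -- p / (1 + q) ≤ log₂ n iff 2 ^ p ≤ n ^ (1 + q), so for n ≥ 1 these are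
  -- exactly the non-negative rationals that are at most log₂ n.
  Log₂Cut : ℕ → ℝ → Set
  Log₂Cut n x = ∃[ p ] ∃[ q ]
    (2 ℕ.^ p ℕ.≤ n ℕ.^ suc q × x ≡ fromℕ p / fromℕ (suc q))

  private
    open RingProperties (CommutativeRing.ring commutativeRing)
      using (-‿distribˡ-*; -‿distribʳ-*; -‿involutive)

    +-monoʳ-≤ : ∀ z {x y} → x ≤ y → z + x ≤ z + y
    +-monoʳ-≤ z {x} {y} x≤y = subst₂ _≤_ (+-comm x z) (+-comm y z) (+-monoˡ-≤ z x≤y)

    0≤1 : 0# ≤ 1#
    0≤1 with ≤-total 0# 1#
    ... | inj₁ p = p
    ... | inj₂ 1≤0 = subst (0# ≤_) eq (*-nonNegative 0≤-1 0≤-1)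
      where
      0≤-1 : 0# ≤ - 1#
      0≤-1 = subst₂ _≤_ (-‿inverseʳ 1#) (+-identityˡ (- 1#)) (+-monoˡ-≤ (- 1#) 1≤0)
      eq : - 1# * - 1# ≡ 1#
      eq = trans (sym (-‿distribˡ-* 1# (- 1#)))
                 (trans (cong -_ (*-identityˡ (- 1#))) (-‿involutive 1#))

    fromℕ-nonNegative : ∀ n → 0# ≤ fromℕ n
    fromℕ-nonNegative zero    = ≤-refl
    fromℕ-nonNegative (suc n) =
      ≤-trans (fromℕ-nonNegative n)
              (subst (_≤ 1# + fromℕ n) (+-identityˡ (fromℕ n)) (+-monoˡ-≤ (fromℕ n) 0≤1))

    fromℕ-mono-≤ : ∀ {m n} → m ℕ.≤ n → fromℕ m ≤ fromℕ n
    fromℕ-mono-≤ {n = n} z≤n = fromℕ-nonNegative n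
    fromℕ-mono-≤ (s≤s m≤n)   = +-monoʳ-≤ 1# (fromℕ-mono-≤ m≤n)

    fromℕ-suc≢0 : ∀ n → fromℕ (suc n) ≢ 0#
    fromℕ-suc≢0 n eq = 0≢1 (≤-antisym 0≤1 (subst (1# ≤_) eq
      (subst (_≤ 1# + fromℕ n) (+-identityʳ 1#) (+-monoʳ-≤ 1# (fromℕ-nonNegative n)))))

    fromℕ-+ : ∀ m n → fromℕ (m ℕ.+ n) ≡ fromℕ m + fromℕ n
    fromℕ-+ zero    n = sym (+-identityˡ (fromℕ n))
    fromℕ-+ (suc m) n = trans (cong (1# +_) (fromℕ-+ m n)) (sym (+-assoc 1# (fromℕ m) (fromℕ n)))

    fromℕ-* : ∀ m n → fromℕ (m ℕ.* n) ≡ fromℕ m * fromℕ n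
    fromℕ-* zero    n = sym (zeroˡ (fromℕ n))
    fromℕ-* (suc m) n = trans (fromℕ-+ n (m ℕ.* n))
      (trans (cong₂ _+_ (sym (*-identityˡ (fromℕ n))) (fromℕ-* m n))
             (sym (distribʳ (fromℕ n) 1# (fromℕ m))))

    *-monoˡ-≤ : ∀ {z x y} → 0# ≤ z → x ≤ y → x * z ≤ y * z
    *-monoˡ-≤ {z} {x} {y} 0≤z x≤y =
      subst₂ _≤_ (+-identityˡ (x * z)) eq (+-monoˡ-≤ (x * z) (*-nonNegative 0≤y-x 0≤z))
      where
      0≤y-x : 0# ≤ y - x
      0≤y-x = subst (_≤ y - x) (-‿inverseʳ x) (+-monoˡ-≤ (- x) x≤y)
      eq : (y - x) * z + x * z ≡ y * z
      eq = trans (sym (distribʳ z (y - x) x)) (cong (_* z)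
        (trans (+-assoc y (- x) x) (trans (cong (y +_) (-‿inverseˡ x)) (+-identityʳ y))))

    /-cancel : ∀ x {z} → z ≢ 0# → x / z * z ≡ x
    /-cancel x {z} z≢0 = trans (*-assoc x (z ⁻¹) z) (trans
      (cong (x *_) (trans (*-comm (z ⁻¹) z) (⁻¹-inverseʳ z z≢0))) (*-identityʳ x))

    *-/-cancel : ∀ x {z} → z ≢ 0# → x * z / z ≡ x
    *-/-cancel x {z} z≢0 = trans (*-assoc x z (z ⁻¹))
      (trans (cong (x *_) (⁻¹-inverseʳ z z≢0)) (*-identityʳ x))

    *-cancelʳ-≤ : ∀ {x y z} → 0# ≤ z → z ≢ 0# → x * z ≤ y * z → x ≤ y
    *-cancelʳ-≤ {x} {y} {z} 0≤z z≢0 xz≤yz with ≤-total x y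
    ... | inj₁ x≤y = x≤y
    ... | inj₂ y≤x = ≤-reflexive (trans (sym (*-/-cancel x z≢0))
      (trans (cong (_/ z) (≤-antisym xz≤yz (*-monoˡ-≤ 0≤z y≤x))) (*-/-cancel y z≢0)))

    n<2^n : ∀ n → n ℕ.< 2 ℕ.^ n
    n<2^n zero    = s≤s z≤n
    n<2^n (suc n) = ℕₚ.+-mono-≤ (ℕₚ.m^n>0 2 n)
      (ℕₚ.≤-trans (n<2^n n) (ℕₚ.m≤m+n (2 ℕ.^ n) 0))

    exponent-bound : ∀ n p q → 2 ℕ.^ p ℕ.≤ n ℕ.^ suc q → p ℕ.≤ n ℕ.* suc q
    exponent-bound n p q h = ℕₚ.≮⇒≥ λ nq<p → ℕₚ.<-irrefl refl
      (ℕₚ.<-≤-trans (ℕₚ.^-monoʳ-< 2 (s≤s (s≤s z≤n)) nq<p)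
        (ℕₚ.≤-trans h (ℕₚ.≤-trans
          (ℕₚ.^-monoˡ-≤ (suc q) (ℕₚ.<⇒≤ (n<2^n n)))
          (ℕₚ.≤-reflexive (ℕₚ.^-*-assoc 2 n (suc q))))))

  Log₂Cut-inhabited : ∀ n .{{_ : ℕ.NonZero n}} → ∃ (Log₂Cut n)
  Log₂Cut-inhabited n = _ , 0 , 0 , ℕₚ.m^n>0 n 1 , refl

  Log₂Cut-bounded : ∀ n → ∃ (UpperBound (Log₂Cut n))
  Log₂Cut-bounded n = fromℕ n , λ where
    _ (p , q , h , refl) → *-cancelʳ-≤ (fromℕ-nonNegative (suc q)) (fromℕ-suc≢0 q)
      (subst₂ _≤_ (sym (/-cancel (fromℕ p) (fromℕ-suc≢0 q))) (fromℕ-* n (suc q))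
        (fromℕ-mono-≤ (exponent-bound n p q h)))

  log₂-supremum : ∀ n .{{_ : ℕ.NonZero n}} → ∃ (IsSupremum (Log₂Cut n))
  log₂-supremum n = complete (Log₂Cut n) (Log₂Cut-inhabited n) (Log₂Cut-bounded n)

  -- log₂ 0 is a dummy value.
  log₂ : ℕ → ℝ
  log₂ zero      = 0#
  log₂ n@(suc _) = proj₁ (log₂-supremum n)

  log₂² : ℕ → ℝ
  log₂² n = log₂ n * log₂ n

module OnlineSorting (R : Reals) where
  open Reals R

  Array : ℕ → Set
  Array m = Vec (Maybe ℝ) m

  -- The sentinels 0 and 1 occupy the first and last cells (m ≥ 2).
  initial : ∀ m → Array m
  initial m = tabulate λ i →
    if does (toℕ i ℕₚ.≟ 0) then just 0#
    else if does (suc (toℕ i) ℕₚ.≟ m) then just 1#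
    else nothing

  variation : List ℝ → ℝ
  variation []           = 0#
  variation (x ∷ [])     = 0#
  variation (x ∷ y ∷ xs) = ∣ x - y ∣ + variation (y ∷ xs)

  cost : ∀ {m} → Array m → ℝ
  cost a = variation (catMaybes (toList a))

  -- A deterministic online algorithm chooses the cell of the arriving element
  -- (second argument) from it and the list of earlier arrivals, most recent
  -- first, without the sentinels. This history determines the whole state.
  Algorithm : ℕ → Set
  Algorithm m = List ℝ → ℝ → Fin m

  -- A ⊢ xs ⇓ a: when the elements of xs arrive, last entry of the list first,
  -- A always chooses an empty cell and the resulting array is a.
  infix 3 _⊢_⇓_
  data _⊢_⇓_ {m} (A : Algorithm m) : List ℝ → Array m → Set where
    start  : A ⊢ [] ⇓ initial m
    insert : ∀ {xs a} x → A ⊢ xs ⇓ a →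
             lookup a (A xs x) ≡ nothing →
             A ⊢ x ∷ xs ⇓ (a [ A xs x ]≔ just x)

  InUnitInterval : ℝ → Set
  InUnitInterval x = 0# ≤ x × x ≤ 1#

  -- The n elements include the two sentinels, so n - 2 of them arrive online.
  SortsWithCost : ∀ {m} → Algorithm m → ℕ → ℝ → Set
  SortsWithCost A n c =
    ∀ xs → 2 ℕ.+ length xs ≡ n → All InUnitInterval xs →
    ∃[ a ] (A ⊢ xs ⇓ a) × cost a ≤ c

  -- Some online algorithm for n elements uses an array of at most s cells and
  -- has cost at most c on every input.
  OnlineSortable : ℕ → ℝ → ℝ → Set
  OnlineSortable n s c =
    ∃[ m ] n ℕ.≤ m × fromℕ m ≤ s ×
    ∃[ A ] SortsWithCost {m} A n c

{-# OPTIONS --safe #-}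

-- Fix a depth L and call 2^-L a unit. A node of height h is a dyadic interval
-- of 2^h units; it owns an array segment consisting of the segments of its two
-- halves followed by a block of 2^h cells of its own. A block of a node of
-- height h + 1 consists of two slots of 2^h cells, which are handed to the
-- halves on demand: a half all of whose blocks are used up asks its parent for
-- the next slot, and the parent, if its blocks are used up too, first asks for
-- another block for itself. The root takes further blocks from a reserve.
--
-- If e is the number of extra blocks of a node and e₁, e₂ those of its halves,
-- then 2 e ≤ e₁ + e₂, because only the last extra block can have an unused slot
-- and the node's own block makes up for it. So the extra blocks of the nodes of
-- any one height contain at most n cells in total. Each extra block costs a
-- detour of at most twice its width, hence a height costs 2 n units, and the
-- total is at most 1 + 2 (L + 1) n / 2^L with 2 n + (L + 1) 2^L cells. The
-- largest L for which the array fits into γ n cells, but at most 2 log n,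
-- gives the claim.
module Submission where

open import Defs
open import Algebra.Bundles using (CommutativeRing)
import Algebra.Properties.Ring as RingProperties
open import Data.Bool.Base using (if_then_else_)
open import Data.Fin.Base using (Fin; zero; suc; toℕ)
open import Data.List.Base using (List; []; _∷_; _∷ʳ_; catMaybes; drop; length)
import Data.List.Properties as Listₚ
open import Data.List.Relation.Ternary.Interleaving.Propositional
  using (Interleaving; []; consˡ; consʳ)
open import Data.List.Relation.Ternary.Interleaving.Properties using (interleave-length)
open import Data.List.Relation.Unary.All using (All; []; _∷_)
open import Data.Maybe.Base using (just; nothing)
open import Data.Nat.Base as ℕ using (ℕ; zero; suc; z≤n; s≤s)
open import Data.Nat.DivMod using (m/n*n≤m; m≡m%n+[m/n]*n; m%n<n; m*n/n≡m; /-monoˡ-≤)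
import Data.Nat.Properties as ℕₚ
open import Data.Nat.Tactic.RingSolver using (solve-∀)
open import Data.Product.Base using (∃-syntax; _×_; _,_; proj₁; proj₂)
open import Data.Sum.Base using (_⊎_; inj₁; inj₂)
open import Data.Vec.Base using ([]; _∷_; _++_; lookup; replicate; tabulate; toList; _[_]≔_)
open import Level using (0ℓ)
open import Relation.Binary.Bundles using (Poset)
open import Relation.Binary.PropositionalEquality
import Relation.Binary.Reasoning.PartialOrder as PartialOrderReasoning
open import Relation.Binary.Structures using (IsDecTotalOrder)
open import Relation.Nullary.Decidable using (Dec; yes; no; does)
open import Relation.Nullary.Negation using (¬_; contradiction)

-- Ordered field arithmetic and absolute values.

module OrderedField (R : Reals) where
  open Reals R
  open RingProperties (CommutativeRing.ring commutativeRing)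
    using (-‿distribˡ-*; -‿involutive; -‿+-comm)

  ≤-poset : Poset 0ℓ 0ℓ 0ℓ
  ≤-poset = record { isPartialOrder = IsDecTotalOrder.isPartialOrder isDecTotalOrder }

  module ≤-Reasoning = PartialOrderReasoning ≤-poset
  open ≤-Reasoning

  +-monoʳ-≤ : ∀ z {x y} → x ≤ y → z + x ≤ z + y
  +-monoʳ-≤ z {x} {y} x≤y = subst₂ _≤_ (+-comm x z) (+-comm y z) (+-monoˡ-≤ z x≤y)

  +-mono-≤ : ∀ {x y z w} → x ≤ y → z ≤ w → x + z ≤ y + w
  +-mono-≤ {y = y} {z} x≤y z≤w = ≤-trans (+-monoˡ-≤ z x≤y) (+-monoʳ-≤ y z≤w)

  x+y-y≡x : ∀ x y → (x + y) - y ≡ x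
  x+y-y≡x x y = trans (+-assoc x y (- y))
    (trans (cong (x +_) (-‿inverseʳ y)) (+-identityʳ x))

  x-y+y≡x : ∀ x y → (x - y) + y ≡ x
  x-y+y≡x x y = trans (+-assoc x (- y) y)
    (trans (cong (x +_) (-‿inverseˡ y)) (+-identityʳ x))

  +-cancelʳ-≤ : ∀ z {x y} → x + z ≤ y + z → x ≤ y
  +-cancelʳ-≤ z {x} {y} p = subst₂ _≤_ (x+y-y≡x x z) (x+y-y≡x y z) (+-monoˡ-≤ (- z) p)

  x≤x+y : ∀ {x y} → 0# ≤ y → x ≤ x + y
  x≤x+y {x} {y} 0≤y = subst (_≤ x + y) (+-identityʳ x) (+-monoʳ-≤ x 0≤y)

  *-monoˡ-≤ : ∀ {z x y} → 0# ≤ z → x ≤ y → x * z ≤ y * z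
  *-monoˡ-≤ {z} {x} {y} 0≤z x≤y = begin
    x * z                 ≡⟨ +-identityˡ (x * z) ⟨
    0# + x * z            ≤⟨ +-monoˡ-≤ (x * z) (*-nonNegative 0≤y-x 0≤z) ⟩
    (y - x) * z + x * z   ≡⟨ distribʳ z (y - x) x ⟨
    ((y - x) + x) * z     ≡⟨ cong (_* z) (x-y+y≡x y x) ⟩
    y * z                 ∎
    where
    0≤y-x : 0# ≤ y - x
    0≤y-x = subst (_≤ y - x) (-‿inverseʳ x) (+-monoˡ-≤ (- x) x≤y)

  *-monoʳ-≤ : ∀ {z x y} → 0# ≤ z → x ≤ y → z * x ≤ z * y
  *-monoʳ-≤ {z} {x} {y} 0≤z x≤y = subst₂ _≤_ (*-comm x z) (*-comm y z) (*-monoˡ-≤ 0≤z x≤y)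

  *-mono-≤ : ∀ {x y z w} → 0# ≤ z → 0# ≤ y → x ≤ y → z ≤ w → x * z ≤ y * w
  *-mono-≤ 0≤z 0≤y x≤y z≤w = ≤-trans (*-monoˡ-≤ 0≤z x≤y) (*-monoʳ-≤ 0≤y z≤w)

  0≤x² : ∀ x → 0# ≤ x * x
  0≤x² x with ≤-total 0# x
  ... | inj₁ 0≤x = *-nonNegative 0≤x 0≤x
  ... | inj₂ x≤0 = subst (0# ≤_) eq (*-nonNegative 0≤-x 0≤-x)
    where
    0≤-x : 0# ≤ - x
    0≤-x = subst₂ _≤_ (-‿inverseʳ x) (+-identityˡ (- x)) (+-monoˡ-≤ (- x) x≤0)
    eq : - x * - x ≡ x * x
    eq = trans (sym (-‿distribˡ-* x (- x)))
      (trans (cong -_ (trans (*-comm x (- x)) (sym (-‿distribˡ-* x x)))) (-‿involutive (x * x)))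

  0≤1 : 0# ≤ 1#
  0≤1 = subst (0# ≤_) (*-identityˡ 1#) (0≤x² 1#)

  1≤x⇒0≤x : ∀ {x} → 1# ≤ x → 0# ≤ x
  1≤x⇒0≤x = ≤-trans 0≤1

  1≤x⇒0<x : ∀ {x} → 1# ≤ x → 0# < x
  1≤x⇒0<x 1≤x = 1≤x⇒0≤x 1≤x , λ 0≡x → 0≢1 (≤-antisym 0≤1 (subst (1# ≤_) (sym 0≡x) 1≤x))

  /-cancel : ∀ x {z} → 0# < z → x / z * z ≡ x
  /-cancel x {z} (_ , 0≢z) = trans (*-assoc x (z ⁻¹) z) (trans
    (cong (x *_) (trans (*-comm (z ⁻¹) z) (⁻¹-inverseʳ z (≢-sym 0≢z)))) (*-identityʳ x))

  *-/-cancel : ∀ x {z} → 0# < z → x * z / z ≡ x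
  *-/-cancel x {z} (_ , 0≢z) = trans (*-assoc x z (z ⁻¹))
    (trans (cong (x *_) (⁻¹-inverseʳ z (≢-sym 0≢z))) (*-identityʳ x))

  *-cancelʳ-≤ : ∀ {x y z} → 0# < z → x * z ≤ y * z → x ≤ y
  *-cancelʳ-≤ {x} {y} {z} 0<z@(0≤z , _) xz≤yz with ≤-total x y
  ... | inj₁ x≤y = x≤y
  ... | inj₂ y≤x = ≤-reflexive (trans (sym (*-/-cancel x 0<z))
    (trans (cong (_/ z) (≤-antisym xz≤yz (*-monoˡ-≤ 0≤z y≤x))) (*-/-cancel y 0<z)))

  0≤x⁻¹ : ∀ {x} → 0# < x → 0# ≤ x ⁻¹
  0≤x⁻¹ {x} 0<x@(_ , 0≢x) = *-cancelʳ-≤ 0<x (subst₂ _≤_ (sym (zeroˡ x))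
    (trans (sym (⁻¹-inverseʳ x (≢-sym 0≢x))) (*-comm x (x ⁻¹))) 0≤1)

  fromℕ-+ : ∀ m n → fromℕ (m ℕ.+ n) ≡ fromℕ m + fromℕ n
  fromℕ-+ zero    n = sym (+-identityˡ (fromℕ n))
  fromℕ-+ (suc m) n = trans (cong (1# +_) (fromℕ-+ m n)) (sym (+-assoc 1# (fromℕ m) (fromℕ n)))

  fromℕ-* : ∀ m n → fromℕ (m ℕ.* n) ≡ fromℕ m * fromℕ n
  fromℕ-* zero    n = sym (zeroˡ (fromℕ n))
  fromℕ-* (suc m) n = trans (fromℕ-+ n (m ℕ.* n))
    (trans (cong₂ _+_ (sym (*-identityˡ (fromℕ n))) (fromℕ-* m n))
           (sym (distribʳ (fromℕ n) 1# (fromℕ m))))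

  fromℕ-1 : fromℕ 1 ≡ 1#
  fromℕ-1 = +-identityʳ 1#

  0≤fromℕ : ∀ n → 0# ≤ fromℕ n
  0≤fromℕ zero    = ≤-refl
  0≤fromℕ (suc n) = ≤-trans 0≤1 (x≤x+y (0≤fromℕ n))

  fromℕ-mono-≤ : ∀ {m n} → m ℕ.≤ n → fromℕ m ≤ fromℕ n
  fromℕ-mono-≤ {n = n} z≤n = 0≤fromℕ n
  fromℕ-mono-≤ (s≤s m≤n)   = +-monoʳ-≤ 1# (fromℕ-mono-≤ m≤n)

  1≤fromℕ : ∀ n .{{_ : ℕ.NonZero n}} → 1# ≤ fromℕ n
  1≤fromℕ (suc n) = x≤x+y (0≤fromℕ n)

  0<fromℕ : ∀ n .{{_ : ℕ.NonZero n}} → 0# < fromℕ n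
  0<fromℕ n = 1≤x⇒0<x (1≤fromℕ n)

  -[x-y]≡y-x : ∀ x y → - (x - y) ≡ y - x
  -[x-y]≡y-x x y = trans (sym (-‿+-comm x (- y)))
    (trans (cong (- x +_) (-‿involutive y)) (+-comm (- x) y))

  ∣x-y∣≤ : ∀ {x y d} → x ≤ y + d → y ≤ x + d → ∣ x - y ∣ ≤ d
  ∣x-y∣≤ {x} {y} {d} x≤y+d y≤x+d with 0# ≤? x - y
  ... | yes _ = subst (x - y ≤_) (trans (cong (_- y) (+-comm y d)) (x+y-y≡x d y))
                  (+-monoˡ-≤ (- y) x≤y+d)
  ... | no  _ = subst₂ _≤_ (sym (-[x-y]≡y-x x y))
                  (trans (cong (_- x) (+-comm x d)) (x+y-y≡x d x)) (+-monoˡ-≤ (- x) y≤x+d)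

  z≤∣z∣ : ∀ z → z ≤ ∣ z ∣
  z≤∣z∣ z with 0# ≤? z
  ... | yes _ = ≤-refl
  ... | no 0≰z with ≤-total 0# z
  ...   | inj₁ 0≤z = contradiction 0≤z 0≰z
  ...   | inj₂ z≤0 = ≤-trans z≤0
    (subst₂ _≤_ (-‿inverseʳ z) (+-identityˡ (- z)) (+-monoˡ-≤ (- z) z≤0))

  -z≤∣z∣ : ∀ z → - z ≤ ∣ z ∣
  -z≤∣z∣ z with 0# ≤? z
  ... | yes 0≤z = ≤-trans
    (subst₂ _≤_ (+-identityˡ (- z)) (-‿inverseʳ z) (+-monoˡ-≤ (- z) 0≤z)) 0≤z
  ... | no _ = ≤-refl

  x≤y+∣x-y∣ : ∀ x y → x ≤ y + ∣ x - y ∣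
  x≤y+∣x-y∣ x y = subst₂ _≤_ (x-y+y≡x x y) (+-comm _ y) (+-monoˡ-≤ y (z≤∣z∣ (x - y)))

  y≤x+∣x-y∣ : ∀ x y → y ≤ x + ∣ x - y ∣
  y≤x+∣x-y∣ x y = subst₂ _≤_
    (trans (cong (_+ x) (-[x-y]≡y-x x y)) (x-y+y≡x y x)) (+-comm _ x)
    (+-monoˡ-≤ x (-z≤∣z∣ (x - y)))

  triangle : ∀ x y z → ∣ x - z ∣ ≤ ∣ x - y ∣ + ∣ y - z ∣
  triangle x y z = ∣x-y∣≤
    (begin
      x                                ≤⟨ x≤y+∣x-y∣ x y ⟩
      y + ∣ x - y ∣                    ≤⟨ +-monoˡ-≤ _ (x≤y+∣x-y∣ y z) ⟩
      (z + ∣ y - z ∣) + ∣ x - y ∣      ≡⟨ +-assoc _ _ _ ⟩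
      z + (∣ y - z ∣ + ∣ x - y ∣)      ≡⟨ cong (z +_) (+-comm _ _) ⟩
      z + (∣ x - y ∣ + ∣ y - z ∣)      ∎)
    (begin
      z                                ≤⟨ y≤x+∣x-y∣ y z ⟩
      y + ∣ y - z ∣                    ≤⟨ +-monoˡ-≤ _ (y≤x+∣x-y∣ x y) ⟩
      (x + ∣ x - y ∣) + ∣ y - z ∣      ≡⟨ +-assoc _ _ _ ⟩
      x + (∣ x - y ∣ + ∣ y - z ∣)      ∎)

  ∣x-x∣≤0 : ∀ x → ∣ x - x ∣ ≤ 0#
  ∣x-x∣≤0 x = ∣x-y∣≤ (≤-reflexive (sym (+-identityʳ x))) (≤-reflexive (sym (+-identityʳ x)))

-- Dyadic block and segment sizes.

pow2 : ℕ → ℕ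
pow2 zero    = 1
pow2 (suc h) = pow2 h ℕ.+ pow2 h

pow2≡2^ : ∀ h → pow2 h ≡ 2 ℕ.^ h
pow2≡2^ zero    = refl
pow2≡2^ (suc h) = cong₂ ℕ._+_ (pow2≡2^ h) (trans (pow2≡2^ h) (sym (ℕₚ.+-identityʳ (2 ℕ.^ h))))

size : ℕ → ℕ
size zero    = 1
size (suc h) = size h ℕ.+ (size h ℕ.+ pow2 (suc h))

-- Each of the `suc h` levels of the tree owns `pow2 h` cells in total.
size≡ : ∀ h → size h ≡ suc h ℕ.* pow2 h
size≡ zero    = refl
size≡ (suc h) = trans (cong (λ s → s ℕ.+ (s ℕ.+ pow2 (suc h))) (size≡ h)) (lemma h (pow2 h))
  where
  lemma : ∀ h p → suc h ℕ.* p ℕ.+ (suc h ℕ.* p ℕ.+ (p ℕ.+ p)) ≡ suc (suc h) ℕ.* (p ℕ.+ p)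
  lemma = solve-∀

replicate-++ : ∀ {A : Set} m n (x : A) → replicate (m ℕ.+ n) x ≡ replicate m x ++ replicate n x
replicate-++ zero    n x = refl
replicate-++ (suc m) n x = cong (x ∷_) (replicate-++ m n x)

-- Placing an element in arrays and in supplies of blocks.

module Layout (R : Reals) where
  open Reals R
  open OnlineSorting R

  free : ∀ m → Array m
  free m = replicate m nothing

  -- The filled cell is kept as a derivation, which passes through `++` by structural recursion;
  -- `index` recovers the position at the end.
  data Fill (x : ℝ) : ∀ {m} → Array m → Array m → Set where
    here  : ∀ {m} {v : Array m} → Fill x (nothing ∷ v) (just x ∷ v)
    there : ∀ {m} {c} {v v′ : Array m} → Fill x v v′ → Fill x (c ∷ v) (c ∷ v′)

  fill-++ˡ : ∀ {x m n} {v v′ : Array m} {w : Array n} → Fill x v v′ → Fill x (v ++ w) (v′ ++ w)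
  fill-++ˡ here      = here
  fill-++ˡ (there f) = there (fill-++ˡ f)

  fill-++ʳ : ∀ {x m n} (u : Array m) {v v′ : Array n} → Fill x v v′ → Fill x (u ++ v) (u ++ v′)
  fill-++ʳ []      f = f
  fill-++ʳ (c ∷ u) f = there (fill-++ʳ u f)

  fill-free-++ : ∀ {x m n} {v : Array m} → Fill x (free m) v → Fill x (free (m ℕ.+ n)) (v ++ free n)
  fill-free-++ {x} {m} {n} {v} f =
    subst (λ w → Fill x w (v ++ free n)) (sym (replicate-++ m n nothing)) (fill-++ˡ f)

  index : ∀ {x m} {v v′ : Array m} → Fill x v v′ → Fin m
  index here      = zero
  index (there f) = suc (index f)

  index-empty : ∀ {x m} {v v′ : Array m} (f : Fill x v v′) → lookup v (index f) ≡ nothing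
  index-empty here      = refl
  index-empty (there f) = index-empty f

  index-update : ∀ {x m} {v v′ : Array m} (f : Fill x v v′) → v′ ≡ v [ index f ]≔ just x
  index-update here              = refl
  index-update (there {c = c} f) = cong (c ∷_) (index-update f)

  -- A list of blocks stands for an unbounded supply of blocks of which all
  -- but the listed ones are free.
  data FillBlock (x : ℝ) {m} : List (Array m) → List (Array m) → Set where
    new   : ∀ {b} → Fill x (free m) b → FillBlock x [] (b ∷ [])
    here  : ∀ {b b′ bs} → Fill x b b′ → FillBlock x (b ∷ bs) (b′ ∷ bs)
    there : ∀ {b bs bs′} → FillBlock x bs bs′ → FillBlock x (b ∷ bs) (b ∷ bs′)

  fillBlock-∷ʳ : ∀ {x m} {b : Array m} bs → Fill x (free m) b → FillBlock x bs (bs ∷ʳ b)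
  fillBlock-∷ʳ []       f = new f
  fillBlock-∷ʳ (_ ∷ bs) f = there (fillBlock-∷ʳ bs f)

  -- A block new to one half is appended behind all slots already handed out, so no slot in use ever
  -- moves.
  fillBlock-interleaveˡ : ∀ {x m} {bs bs′ cs ds : List (Array m)} → FillBlock x bs bs′ →
    Interleaving bs cs ds → ∃[ ds′ ] FillBlock x ds ds′ × Interleaving bs′ cs ds′
  fillBlock-interleaveˡ (new f)   []        = _ , new f , consˡ []
  fillBlock-interleaveˡ (here f)  (consˡ i) = _ , here f , consˡ i
  fillBlock-interleaveˡ (there s) (consˡ i) =
    let _ , s′ , i′ = fillBlock-interleaveˡ s i in _ , there s′ , consˡ i′
  fillBlock-interleaveˡ s         (consʳ i) =
    let _ , s′ , i′ = fillBlock-interleaveˡ s i in _ , there s′ , consʳ i′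

  fillBlock-interleaveʳ : ∀ {x m} {bs cs cs′ ds : List (Array m)} → FillBlock x cs cs′ →
    Interleaving bs cs ds → ∃[ ds′ ] FillBlock x ds ds′ × Interleaving bs cs′ ds′
  fillBlock-interleaveʳ (new f)   []        = _ , new f , consʳ []
  fillBlock-interleaveʳ (here f)  (consʳ i) = _ , here f , consʳ i
  fillBlock-interleaveʳ (there s) (consʳ i) =
    let _ , s′ , i′ = fillBlock-interleaveʳ s i in _ , there s′ , consʳ i′
  fillBlock-interleaveʳ s         (consˡ i) =
    let _ , s′ , i′ = fillBlock-interleaveʳ s i in _ , there s′ , consˡ i′

  -- Turns the slots of a node into its blocks; the partner of an odd last slot has not been handed
  -- out yet.
  pairUp : ∀ {m} → List (Array m) → List (Array (m ℕ.+ m))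
  pairUp     []           = []
  pairUp {m} (b ∷ [])     = (b ++ free m) ∷ []
  pairUp     (b ∷ c ∷ bs) = (b ++ c) ∷ pairUp bs

  -- A new slot is either the free second half of the last block or the first half of a new block.
  fillBlock-pairUp : ∀ {x m} {bs bs′ : List (Array m)} →
    FillBlock x bs bs′ → FillBlock x (pairUp bs) (pairUp bs′)
  fillBlock-pairUp (new f)                           = new (fill-free-++ f)
  fillBlock-pairUp (here {bs = []} f)                = here (fill-++ˡ f)
  fillBlock-pairUp (here {bs = _ ∷ _} f)             = here (fill-++ˡ f)
  fillBlock-pairUp (there {b} (new f))               = here (fill-++ʳ b f)
  fillBlock-pairUp (there {b} (here f))              = here (fill-++ʳ b f)
  fillBlock-pairUp (there (there s))                 = there (fillBlock-pairUp s)

  first : ∀ {m} → List (Array m) → Array m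
  first {m} []      = free m
  first     (b ∷ _) = b

  -- This dichotomy is all that a half reports to its parent: only `outside` forces the parent to
  -- act.
  data Change (x : ℝ) {m n} : (A A′ : Array m) (E E′ : List (Array n)) → Set where
    inside  : ∀ {A A′ E} → Fill x A A′ → Change x A A′ E E
    outside : ∀ {A E E′} → FillBlock x E E′ → Change x A A E E′

  change-first : ∀ {x m} {bs bs′ : List (Array m)} →
    FillBlock x bs bs′ → Change x (first bs) (first bs′) (drop 1 bs) (drop 1 bs′)
  change-first (new f)   = inside f
  change-first (here f)  = inside f
  change-first (there s) = outside s

  change-++ʳ : ∀ {x k m n} (u : Array k) {A A′ : Array m} {E E′ : List (Array n)} →
    Change x A A′ E E′ → Change x (u ++ A) (u ++ A′) E E′
  change-++ʳ u (inside f)  = inside (fill-++ʳ u f)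
  change-++ʳ u (outside s) = outside s

  double-length-pairUp : ∀ {m} (bs : List (Array m)) →
    length (pairUp bs) ℕ.+ length (pairUp bs) ℕ.≤ suc (length bs)
  double-length-pairUp []           = z≤n
  double-length-pairUp (_ ∷ [])     = ℕₚ.≤-refl
  double-length-pairUp (_ ∷ _ ∷ bs) =
    s≤s (subst (ℕ._≤ suc (suc (length bs))) (sym (ℕₚ.+-suc _ _)) (s≤s (double-length-pairUp bs)))

  -- Dropping the node's own block pays for the rounding up in `double-length-pairUp`.
  double-length-drop-pairUp : ∀ {m} (bs : List (Array m)) →
    length (drop 1 (pairUp bs)) ℕ.+ length (drop 1 (pairUp bs)) ℕ.≤ length bs
  double-length-drop-pairUp []           = z≤n
  double-length-drop-pairUp (_ ∷ [])     = z≤n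
  double-length-drop-pairUp (_ ∷ _ ∷ bs) = ℕₚ.m≤n⇒m≤1+n (double-length-pairUp bs)

  pad : ∀ {m} r → List (Array m) → Array (r ℕ.* m)
  pad zero    bs = []
  pad (suc r) bs = first bs ++ pad r (drop 1 bs)

  fill-pad : ∀ {x m r} {bs bs′ : List (Array m)} → FillBlock x bs bs′ →
    length bs′ ℕ.≤ r → Fill x (pad r bs) (pad r bs′)
  fill-pad (new f)   (s≤s _)  = fill-++ˡ f
  fill-pad (here f)  (s≤s _)  = fill-++ˡ f
  fill-pad (there {b} s) (s≤s le) = fill-++ʳ b (fill-pad s le)

  fill-change : ∀ {x m n r} {A A′ : Array m} {E E′ : List (Array n)} →
    Change x A A′ E E′ → length E′ ℕ.≤ r → Fill x (A ++ pad r E) (A′ ++ pad r E′)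
  fill-change         (inside f)         le = fill-++ˡ f
  fill-change {A = A} (outside s) le = fill-++ʳ A (fill-pad s le)

  pad-[] : ∀ {m} r → pad r [] ≡ free (r ℕ.* m)
  pad-[] zero = refl
  pad-[] {m} (suc r) = trans (cong (free m ++_) (pad-[] r)) (sym (replicate-++ m (r ℕ.* m) nothing))

-- States of the dyadic tree, insertion, and the number of extra blocks.

module Structure (R : Reals) (u : Reals.ℝ R) where
  open Reals R
  open OnlineSorting R
  open OrderedField R
  open Layout R

  width : ℕ → ℝ
  width zero    = u
  width (suc h) = width h + width h

  InRange : ℝ → ℕ → ℝ → Set
  InRange a h x = a ≤ x × x ≤ a + width h

  -- State a h N A E: the node of height h with left end a has received N
  -- elements, its own segment has contents A, and its extra blocks, which lie
  -- in slots of its ancestors or in the reserve, have contents E. In a node, S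
  -- lists the slots in the order in which they were handed to the two halves.
  data State (a : ℝ) : (h N : ℕ) → Array (size h) → List (Array (pow2 h)) → Set where
    empty : State a 0 0 (nothing ∷ []) []
    one   : ∀ {x} → InRange a 0 x → State a 0 1 (just x ∷ []) []
    more  : ∀ {x N A E} → State a 0 (suc N) A E → InRange a 0 x →
            State a 0 (suc (suc N)) A (E ∷ʳ (just x ∷ []))
    node  : ∀ {h N₁ N₂ A₁ A₂ E₁ E₂ S} →
            State a h N₁ A₁ E₁ → State (a + width h) h N₂ A₂ E₂ → Interleaving E₁ E₂ S →
            State a (suc h) (N₁ ℕ.+ N₂) (A₁ ++ (A₂ ++ first (pairUp S))) (drop 1 (pairUp S))

  start-state : ∀ a h → State a h 0 (free (size h)) []
  start-state a zero    = empty
  start-state a (suc h) = subst (λ A → State a (suc h) 0 A []) eq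
    (node (start-state a h) (start-state (a + width h) h) [])
    where
    eq : free (size h) ++ (free (size h) ++ free (pow2 (suc h))) ≡ free (size (suc h))
    eq = sym (trans (replicate-++ (size h) _ nothing)
      (cong (free (size h) ++_) (replicate-++ (size h) _ nothing)))

  resize : ∀ {a h M N A E} → M ≡ N → State a h M A E → State a h N A E
  resize refl s = s

  -- Recursion into a half that contains `x`; the intervals are closed, so the midpoint lies in
  -- both. A leaf uses its own cell first and then one extra block per element.
  insertion : ∀ {a h N A E} x → InRange a h x → State a h N A E →
    ∃[ A′ ] ∃[ E′ ] Change x A A′ E E′ × State a h (suc N) A′ E′
  insertion x x∈ empty              = _ , _ , inside here , one x∈
  insertion x x∈ s@(one _)          = _ , _ , outside (new here) , more s x∈
  insertion x x∈ s@(more {E = E} _ _) = _ , _ , outside (fillBlock-∷ʳ _ here) , more s x∈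
  insertion {a} {suc h} x (a≤x , x≤b) (node {A₁ = A₁} {A₂} s₁ s₂ i) with ≤-total x (a + width h)
  ... | inj₁ x≤mid with insertion x (a≤x , x≤mid) s₁
  ...   | _ , _ , inside f , s₁′ = _ , _ , inside (fill-++ˡ f) , node s₁′ s₂ i
  ...   | _ , _ , outside g , s₁′ =
          -- The block filled by the half is a slot of this node, so the change is carried through
          -- the hand-out order, the pairing, and the split into own block and extra blocks.
          let _ , g′ , i′ = fillBlock-interleaveˡ g i
          in  _ , _ , change-++ʳ A₁ (change-++ʳ A₂ (change-first (fillBlock-pairUp g′))) , node s₁′ s₂ i′
  insertion {a} {suc h} x (a≤x , x≤b) (node {N₁ = N₁} {N₂} {A₁} {A₂} s₁ s₂ i)
    | inj₂ mid≤x with insertion x (mid≤x , subst (x ≤_) (sym (+-assoc a _ _)) x≤b) s₂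
  ...   | _ , _ , inside f , s₂′ = _ , _ , inside (fill-++ʳ A₁ (fill-++ˡ f)) ,
          resize (ℕₚ.+-suc N₁ N₂) (node s₁ s₂′ i)
  ...   | _ , _ , outside g , s₂′ =
          let _ , g′ , i′ = fillBlock-interleaveʳ g i
          in  _ , _ , change-++ʳ A₁ (change-++ʳ A₂ (change-first (fillBlock-pairUp g′))) ,
              resize (ℕₚ.+-suc N₁ N₂) (node s₁ s₂′ i′)

  -- Weighting extra blocks by their size turns 2 e ≤ e₁ + e₂ into a bound that adds up over the
  -- halves. At a leaf only the elements after the first take extra blocks.
  extra-bound : ∀ {a h N A E} → State a h N A E → pow2 h ℕ.* length E ℕ.≤ N
  extra-bound empty   = z≤n
  extra-bound (one _) = z≤n
  extra-bound (more {E = E} s _) = ℕₚ.≤-trans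
    (ℕₚ.≤-reflexive (trans (ℕₚ.*-identityˡ _) (trans (Listₚ.length-++ E) (ℕₚ.+-comm (length E) 1))))
    (s≤s (subst (ℕ._≤ _) (ℕₚ.*-identityˡ _) (extra-bound s)))
  extra-bound {h = suc h} (node {N₁ = N₁} {N₂} {E₁ = E₁} {E₂} {S} s₁ s₂ i) = begin
    (p ℕ.+ p) ℕ.* e                   ≡⟨ eq p e ⟩
    p ℕ.* (e ℕ.+ e)                   ≤⟨ ℕₚ.*-monoʳ-≤ p (double-length-drop-pairUp S) ⟩
    p ℕ.* length S                    ≡⟨ cong (p ℕ.*_) (interleave-length i) ⟩
    p ℕ.* (length E₁ ℕ.+ length E₂)   ≡⟨ ℕₚ.*-distribˡ-+ p (length E₁) (length E₂) ⟩
    p ℕ.* length E₁ ℕ.+ p ℕ.* length E₂ ≤⟨ ℕₚ.+-mono-≤ (extra-bound s₁) (extra-bound s₂) ⟩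
    N₁ ℕ.+ N₂                         ∎
    where
    open ℕₚ.≤-Reasoning
    p = pow2 h
    e = length (drop 1 (pairUp S))
    eq : ∀ p e → (p ℕ.+ p) ℕ.* e ≡ p ℕ.* (e ℕ.+ e)
    eq = solve-∀

-- Path costs and loops.

module Cost (R : Reals) where
  open Reals R
  open OnlineSorting R
  open OrderedField R
  open Layout R
  open OrderedField.≤-Reasoning R

  interchange : ∀ a b c d → (a + b) + (c + d) ≡ (a + c) + (b + d)
  interchange a b c d = trans (+-assoc a b (c + d)) (trans
    (cong (a +_) (trans (sym (+-assoc b c d)) (trans (cong (_+ d) (+-comm b c)) (+-assoc c b d))))
    (sym (+-assoc a c (b + d))))

  -- Naming both end points covers arrays without elements and lets a concatenation be split at any
  -- waypoint.
  pathCost : ℝ → ∀ {m} → Array m → ℝ → ℝ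
  pathCost p []            q = ∣ p - q ∣
  pathCost p (nothing ∷ v) q = pathCost p v q
  pathCost p (just x ∷ v)  q = ∣ p - x ∣ + pathCost x v q

  variation-pathCost : ∀ p {m} (v : Array m) q →
    variation (p ∷ catMaybes (toList (v ++ just q ∷ []))) ≡ pathCost p v q
  variation-pathCost p []            q = +-identityʳ ∣ p - q ∣
  variation-pathCost p (nothing ∷ v) q = variation-pathCost p v q
  variation-pathCost p (just x ∷ v)  q = cong (∣ p - x ∣ +_) (variation-pathCost x v q)

  pathCost-moveˡ : ∀ p r {m} (v : Array m) q → pathCost p v q ≤ ∣ p - r ∣ + pathCost r v q
  pathCost-moveˡ p r []            q = triangle p r q
  pathCost-moveˡ p r (nothing ∷ v) q = pathCost-moveˡ p r v q
  pathCost-moveˡ p r (just x ∷ v)  q = begin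
    ∣ p - x ∣ + pathCost x v q                  ≤⟨ +-monoˡ-≤ _ (triangle p r x) ⟩
    (∣ p - r ∣ + ∣ r - x ∣) + pathCost x v q    ≡⟨ +-assoc _ _ _ ⟩
    ∣ p - r ∣ + (∣ r - x ∣ + pathCost x v q)    ∎

  -- By the triangle inequality, forcing the path through the waypoint `r` between the two arrays
  -- can only lengthen it.
  pathCost-++ : ∀ p {m n} (v : Array m) (w : Array n) r q →
    pathCost p (v ++ w) q ≤ pathCost p v r + pathCost r w q
  pathCost-++ p []            w r q = pathCost-moveˡ p r w q
  pathCost-++ p (nothing ∷ v) w r q = pathCost-++ p v w r q
  pathCost-++ p (just x ∷ v)  w r q = begin
    ∣ p - x ∣ + pathCost x (v ++ w) q                   ≤⟨ +-monoʳ-≤ _ (pathCost-++ x v w r q) ⟩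
    ∣ p - x ∣ + (pathCost x v r + pathCost r w q)       ≡⟨ +-assoc _ _ _ ⟨
    (∣ p - x ∣ + pathCost x v r) + pathCost r w q       ∎

  pathCost-moveʳ : ∀ p {m} (v : Array m) q r → pathCost p v q ≤ pathCost p v r + ∣ r - q ∣
  pathCost-moveʳ p []            q r = triangle p r q
  pathCost-moveʳ p (nothing ∷ v) q r = pathCost-moveʳ p v q r
  pathCost-moveʳ p (just x ∷ v)  q r = begin
    ∣ p - x ∣ + pathCost x v q                    ≤⟨ +-monoʳ-≤ _ (pathCost-moveʳ x v q r) ⟩
    ∣ p - x ∣ + (pathCost x v r + ∣ r - q ∣)      ≡⟨ +-assoc _ _ _ ⟨
    (∣ p - x ∣ + pathCost x v r) + ∣ r - q ∣      ∎

  loop : ℝ → ∀ {m} → Array m → ℝ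
  loop p v = pathCost p v p

  loop-free : ∀ p m → loop p (free m) ≤ 0#
  loop-free p zero    = ∣x-x∣≤0 p
  loop-free p (suc m) = loop-free p m

  loops : ℝ → ∀ {m} → List (Array m) → ℝ
  loops p []       = 0#
  loops p (b ∷ bs) = loop p b + loops p bs

  loops-∷ʳ : ∀ p {m} (bs : List (Array m)) b → loops p (bs ∷ʳ b) ≡ loops p bs + loop p b
  loops-∷ʳ p []       b = +-comm (loop p b) 0#
  loops-∷ʳ p (c ∷ bs) b = trans (cong (loop p c +_) (loops-∷ʳ p bs b)) (sym (+-assoc _ _ _))

  loops-interleave : ∀ p {m} {bs cs ds : List (Array m)} → Interleaving bs cs ds →
    loops p ds ≡ loops p bs + loops p cs
  loops-interleave p []        = sym (+-identityʳ 0#)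
  loops-interleave p (consˡ i) = trans (cong (_ +_) (loops-interleave p i)) (sym (+-assoc _ _ _))
  loops-interleave p {bs = bs} {c ∷ cs} (consʳ i) = trans (cong (loop p c +_) (loops-interleave p i))
    (trans (sym (+-assoc _ _ _)) (trans (cong (_+ loops p cs) (+-comm (loop p c) (loops p bs)))
      (+-assoc _ _ _)))

  -- Returning to `p` between the two slots of a block can only lengthen the trip, and a free second
  -- slot costs nothing.
  loops-pairUp : ∀ p {m} (bs : List (Array m)) → loops p (pairUp bs) ≤ loops p bs
  loops-pairUp p         []           = ≤-refl
  loops-pairUp p {m = m} (b ∷ [])     = +-monoˡ-≤ 0# (begin
    loop p (b ++ free m)         ≤⟨ pathCost-++ p b (free m) p p ⟩
    loop p b + loop p (free m)   ≤⟨ +-monoʳ-≤ _ (loop-free p m) ⟩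
    loop p b + 0#                ≡⟨ +-identityʳ _ ⟩
    loop p b                     ∎)
  loops-pairUp p         (b ∷ c ∷ bs) = begin
    loop p (b ++ c) + loops p (pairUp bs)      ≤⟨ +-mono-≤ (pathCost-++ p b c p p) (loops-pairUp p bs) ⟩
    (loop p b + loop p c) + loops p bs         ≡⟨ +-assoc _ _ _ ⟩
    loop p b + (loop p c + loops p bs)         ∎

  loops-first-drop : ∀ p {m} (bs : List (Array m)) → loop p (first bs) + loops p (drop 1 bs) ≤ loops p bs
  loops-first-drop p {m} []       = subst (loop p (free m) + 0# ≤_) (+-identityʳ 0#) (+-monoˡ-≤ 0# (loop-free p m))
  loops-first-drop p     (b ∷ bs) = ≤-refl

  loops-pad : ∀ p {m} r (bs : List (Array m)) → length bs ℕ.≤ r → loop p (pad r bs) ≤ loops p bs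
  loops-pad p {m} zero    []       _        = ∣x-x∣≤0 p
  loops-pad p {m} (suc r) []       _        = begin
    loop p (free m ++ pad r [])             ≤⟨ pathCost-++ p (free m) (pad r []) p p ⟩
    loop p (free m) + loop p (pad {m} r []) ≤⟨ +-mono-≤ (loop-free p m) (loops-pad p {m} r [] z≤n) ⟩
    0# + 0#                                 ≡⟨ +-identityʳ 0# ⟩
    0#                                      ∎
  loops-pad p     (suc r) (b ∷ bs) (s≤s le) =
    ≤-trans (pathCost-++ p b (pad r bs) p p) (+-monoʳ-≤ _ (loops-pad p r bs le))

  -- Each block pays `d` to travel from `p` to `q` and `d` to return.
  loops-move : ∀ p q {d} → ∣ p - q ∣ ≤ d → ∣ q - p ∣ ≤ d → ∀ {m} (bs : List (Array m)) →
    loops p bs ≤ loops q bs + fromℕ (length bs) * (d + d)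
  loops-move p q {d} pq≤d qp≤d []       = ≤-reflexive (sym (trans (+-identityˡ _) (zeroˡ _)))
  loops-move p q {d} pq≤d qp≤d (b ∷ bs) = begin
    loop p b + loops p bs
      ≤⟨ +-mono-≤ (begin
           loop p b                                  ≤⟨ pathCost-moveˡ p q b p ⟩
           ∣ p - q ∣ + pathCost q b p                ≤⟨ +-mono-≤ pq≤d (pathCost-moveʳ q b p q) ⟩
           d + (loop q b + ∣ q - p ∣)                ≤⟨ +-monoʳ-≤ d (+-monoʳ-≤ _ qp≤d) ⟩
           d + (loop q b + d)                        ≡⟨ +-comm d _ ⟩
           (loop q b + d) + d                        ≡⟨ +-assoc _ d d ⟩
           loop q b + (d + d)                        ∎)
         (loops-move p q pq≤d qp≤d bs) ⟩
    (loop q b + (d + d)) + (loops q bs + k * (d + d)) ≡⟨ interchange _ _ _ _ ⟩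
    (loop q b + loops q bs) + ((d + d) + k * (d + d))
      ≡⟨ cong (loops q (b ∷ bs) +_) (trans (cong (_+ k * (d + d)) (sym (*-identityˡ (d + d))))
           (sym (distribʳ (d + d) 1# k))) ⟩
    loops q (b ∷ bs) + (1# + k) * (d + d)             ∎
    where k = fromℕ (length bs)

-- Cost of a state, in units.

module StateCost (R : Reals) (u : Reals.ℝ R) (0≤u : Reals._≤_ R (Reals.0# R) u) where
  open Reals R
  open OnlineSorting R
  open OrderedField R
  open Layout R
  open Cost R
  open Structure R u
  open OrderedField.≤-Reasoning R

  units : ℕ → ℝ
  units k = fromℕ k * u

  units-+ : ∀ j k → units (j ℕ.+ k) ≡ units j + units k
  units-+ j k = trans (cong (_* u) (fromℕ-+ j k)) (distribʳ u _ _)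

  units-mono-≤ : ∀ {j k} → j ℕ.≤ k → units j ≤ units k
  units-mono-≤ j≤k = *-monoˡ-≤ 0≤u (fromℕ-mono-≤ j≤k)

  0≤units : ∀ k → 0# ≤ units k
  0≤units k = *-nonNegative (0≤fromℕ k) 0≤u

  width≡units : ∀ h → width h ≡ units (pow2 h)
  width≡units zero    = sym (trans (cong (_* u) fromℕ-1) (*-identityˡ u))
  width≡units (suc h) = trans (cong₂ _+_ (width≡units h) (width≡units h)) (sym (units-+ (pow2 h) (pow2 h)))

  0≤width : ∀ h → 0# ≤ width h
  0≤width h = subst (0# ≤_) (sym (width≡units h)) (0≤units (pow2 h))

  a≤a+width : ∀ {a} h → a ≤ a + width h
  a≤a+width h = x≤x+y (0≤width h)

  close : ∀ {a} h {x y} → InRange a h x → InRange a h y → ∣ x - y ∣ ≤ width h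
  close h (a≤x , x≤b) (a≤y , y≤b) =
    ∣x-y∣≤ (≤-trans x≤b (+-monoˡ-≤ (width h) a≤y)) (≤-trans y≤b (+-monoˡ-≤ (width h) a≤x))

  lower : ∀ {a} h → InRange a h a
  lower h = ≤-refl , a≤a+width h

  upper : ∀ {a} h → InRange a h (a + width h)
  upper h = a≤a+width h , ≤-refl

  -- An extra block is charged for a round trip from the right end of the
  -- interval; all nodes use that end, so only left halves pay for detours.
  stateCost : ∀ {a h N A E} → State a h N A E → ℝ
  stateCost {a} {h} {A = A} {E} _ = pathCost a A (a + width h) + loops (a + width h) E

  -- The term `pow2 h` is the straight walk across the interval; each of the `suc h` levels adds at
  -- most two units per element for trips into extra blocks.
  stateCost-bound : ∀ {a h N A E} (s : State a h N A E) →
    stateCost s ≤ units (pow2 h ℕ.+ 2 ℕ.* (suc h ℕ.* N))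
  stateCost-bound empty = begin
    _                   ≡⟨ +-identityʳ _ ⟩
    _                   ≤⟨ close 0 (lower 0) (upper 0) ⟩
    width 0             ≡⟨ width≡units 0 ⟩
    units 1             ∎
  stateCost-bound (one x∈) = begin
    _                   ≡⟨ +-identityʳ _ ⟩
    _                   ≤⟨ +-mono-≤ (close 0 (lower 0) x∈) (close 0 x∈ (upper 0)) ⟩
    width 1             ≡⟨ width≡units 1 ⟩
    units 2             ≤⟨ units-mono-≤ {2} {3} (s≤s (s≤s z≤n)) ⟩
    units 3             ∎
  stateCost-bound {a} (more {N = N} {A} {E} s x∈) = begin
    pathCost a A b + loops b (E ∷ʳ _)       ≡⟨ cong (pathCost a A b +_) (loops-∷ʳ b E _) ⟩
    pathCost a A b + (loops b E + _)        ≡⟨ +-assoc _ _ _ ⟨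
    (pathCost a A b + loops b E) + _
      ≤⟨ +-mono-≤ (stateCost-bound s) (+-mono-≤ (close 0 (upper 0) x∈) (close 0 x∈ (upper 0))) ⟩
    units (1 ℕ.+ 2 ℕ.* (1 ℕ.* suc N)) + width 1   ≡⟨ cong (units (1 ℕ.+ 2 ℕ.* (1 ℕ.* suc N)) +_) (width≡units 1) ⟩
    units (1 ℕ.+ 2 ℕ.* (1 ℕ.* suc N)) + units 2   ≡⟨ units-+ (1 ℕ.+ 2 ℕ.* (1 ℕ.* suc N)) 2 ⟨
    units ((1 ℕ.+ 2 ℕ.* (1 ℕ.* suc N)) ℕ.+ 2)     ≡⟨ cong units (eq N) ⟩
    units (1 ℕ.+ 2 ℕ.* (1 ℕ.* suc (suc N)))       ∎
    where
    b = a + width 0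
    eq : ∀ N → (1 ℕ.+ 2 ℕ.* (1 ℕ.* suc N)) ℕ.+ 2 ≡ 1 ℕ.+ 2 ℕ.* (1 ℕ.* suc (suc N))
    eq = solve-∀
  stateCost-bound {a} {suc h} (node {N₁ = N₁} {N₂} {A₁} {A₂} {E₁} {E₂} {S} s₁ s₂ i) = begin
    pathCost a (A₁ ++ (A₂ ++ F)) b′ + loops b′ (drop 1 (pairUp S))
      ≡⟨ cong (λ q → pathCost a (A₁ ++ (A₂ ++ F)) q + loops q (drop 1 (pairUp S))) (sym (+-assoc a _ _)) ⟩
    pathCost a (A₁ ++ (A₂ ++ F)) b + loops b (drop 1 (pairUp S))
      ≤⟨ +-monoˡ-≤ _ (≤-trans (pathCost-++ a A₁ (A₂ ++ F) mid b)
           (+-monoʳ-≤ _ (pathCost-++ mid A₂ F b b))) ⟩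
    (c₁ + (c₂ + loop b F)) + loops b (drop 1 (pairUp S))
      ≡⟨ trans (cong (_+ loops b (drop 1 (pairUp S))) (sym (+-assoc c₁ c₂ _))) (+-assoc (c₁ + c₂) _ _) ⟩
    (c₁ + c₂) + (loop b F + loops b (drop 1 (pairUp S)))
      ≤⟨ +-monoʳ-≤ _ (≤-trans (loops-first-drop b (pairUp S)) (loops-pairUp b S)) ⟩
    (c₁ + c₂) + loops b S                       ≡⟨ cong ((c₁ + c₂) +_) (loops-interleave b i) ⟩
    (c₁ + c₂) + (loops b E₁ + loops b E₂)       ≡⟨ interchange _ _ _ _ ⟩
    (c₁ + loops b E₁) + (c₂ + loops b E₂)       ≤⟨ +-mono-≤ left-bound (stateCost-bound s₂) ⟩
    units (k₁ ℕ.+ 2 ℕ.* N₁) + units k₂          ≡⟨ units-+ (k₁ ℕ.+ 2 ℕ.* N₁) k₂ ⟨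
    -- Only the left half has paid for detours; the added `2 ℕ.* N₂` makes the bound depend on
    -- `N₁ ℕ.+ N₂` alone.
    units ((k₁ ℕ.+ 2 ℕ.* N₁) ℕ.+ k₂)            ≤⟨ units-mono-≤ (ℕₚ.m≤m+n ((k₁ ℕ.+ 2 ℕ.* N₁) ℕ.+ k₂) (2 ℕ.* N₂)) ⟩
    units (((k₁ ℕ.+ 2 ℕ.* N₁) ℕ.+ k₂) ℕ.+ 2 ℕ.* N₂) ≡⟨ cong units (eq (pow2 h) h N₁ N₂) ⟩
    units (pow2 (suc h) ℕ.+ 2 ℕ.* (suc (suc h) ℕ.* (N₁ ℕ.+ N₂))) ∎
    where
    mid = a + width h
    b   = mid + width h
    b′  = a + width (suc h)
    F   = first (pairUp S)
    c₁  = pathCost a A₁ mid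
    c₂  = pathCost mid A₂ b
    k₁  = pow2 h ℕ.+ 2 ℕ.* (suc h ℕ.* N₁)
    k₂  = pow2 h ℕ.+ 2 ℕ.* (suc h ℕ.* N₂)

    eq : ∀ p h M N → ((p ℕ.+ 2 ℕ.* (suc h ℕ.* M) ℕ.+ 2 ℕ.* M) ℕ.+ (p ℕ.+ 2 ℕ.* (suc h ℕ.* N))) ℕ.+ 2 ℕ.* N
                   ≡ (p ℕ.+ p) ℕ.+ 2 ℕ.* (suc (suc h) ℕ.* (M ℕ.+ N))
    eq = solve-∀

    -- Moving the base point from `mid` to `b` costs twice `width h` per extra block of the left
    -- half, and these blocks have at most `N₁` cells in total.
    detours : fromℕ (length E₁) * (width h + width h) ≤ units (2 ℕ.* N₁)
    detours = begin
      fromℕ (length E₁) * width (suc h)             ≡⟨ cong (fromℕ (length E₁) *_) (width≡units (suc h)) ⟩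
      fromℕ (length E₁) * (fromℕ (pow2 (suc h)) * u) ≡⟨ *-assoc _ _ u ⟨
      (fromℕ (length E₁) * fromℕ (pow2 (suc h))) * u ≡⟨ cong (_* u) (fromℕ-* (length E₁) _) ⟨
      units (length E₁ ℕ.* pow2 (suc h))            ≡⟨ cong units (eq′ (length E₁) (pow2 h)) ⟩
      units (2 ℕ.* (pow2 h ℕ.* length E₁))          ≤⟨ units-mono-≤ (ℕₚ.*-monoʳ-≤ 2 (extra-bound s₁)) ⟩
      units (2 ℕ.* N₁)                              ∎
      where
      eq′ : ∀ e p → e ℕ.* (p ℕ.+ p) ≡ 2 ℕ.* (p ℕ.* e)
      eq′ = solve-∀

    left-bound : c₁ + loops b E₁ ≤ units (k₁ ℕ.+ 2 ℕ.* N₁)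
    left-bound = begin
      c₁ + loops b E₁
        ≤⟨ +-monoʳ-≤ c₁ (loops-move b mid (close h (upper h) (lower h)) (close h (lower h) (upper h)) E₁) ⟩
      c₁ + (loops mid E₁ + fromℕ (length E₁) * (width h + width h)) ≡⟨ +-assoc _ _ _ ⟨
      (c₁ + loops mid E₁) + fromℕ (length E₁) * (width h + width h)
        ≤⟨ +-mono-≤ (stateCost-bound s₁) detours ⟩
      units k₁ + units (2 ℕ.* N₁)                   ≡⟨ units-+ k₁ _ ⟨
      units (k₁ ℕ.+ 2 ℕ.* N₁)                       ∎

1≤pow2 : ∀ h → 1 ℕ.≤ pow2 h
1≤pow2 zero    = ℕₚ.≤-refl
1≤pow2 (suc h) = ℕₚ.m≤n⇒m≤n+o (pow2 h) (1≤pow2 h)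

pow2-nonZero : ∀ h → ℕ.NonZero (pow2 h)
pow2-nonZero h = ℕ.>-nonZero (1≤pow2 h)

-- The online algorithm of depth `L`.

module Sorter (R : Reals) (L n : ℕ) where
  open Reals R
  open OnlineSorting R
  open OrderedField R
  open Layout R
  open Cost R

  private instance
    2^L-nonZero : ℕ.NonZero (pow2 L)
    2^L-nonZero = pow2-nonZero L

  -- Makes the root interval of `pow2 L` units equal to [0, 1].
  unit : ℝ
  unit = fromℕ (pow2 L) ⁻¹

  open StateCost R unit (0≤x⁻¹ (0<fromℕ (pow2 L)))
  open Structure R unit
  open OrderedField.≤-Reasoning R hiding (start)

  -- Rounding down is safe: the root has an integral number of extra blocks, with at most as many
  -- cells in total as elements arrived.
  reserve : ℕ
  reserve = n ℕ./ pow2 L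

  0+width≡1 : 0# + width L ≡ 1#
  0+width≡1 = trans (+-identityˡ _) (trans (width≡units L)
    (⁻¹-inverseʳ _ (≢-sym (proj₂ (0<fromℕ (pow2 L))))))

  -- Algorithms are total, so elements outside [0, 1] are replaced by 0.
  clamp : ℝ → ∃[ y ] InRange 0# L y
  clamp x with 0# ≤? x | x ≤? 0# + width L
  ... | yes 0≤x | yes x≤1 = x , 0≤x , x≤1
  ... | _       | _       = 0# , lower L

  clamp-id : ∀ {x} → InUnitInterval x → proj₁ (clamp x) ≡ x
  clamp-id {x} (0≤x , x≤1) with 0# ≤? x | x ≤? 0# + width L
  ... | yes _  | yes _  = refl
  ... | yes _  | no x≰1 = contradiction (subst (x ≤_) (sym 0+width≡1) x≤1) x≰1
  ... | no 0≰x | _      = contradiction 0≤x 0≰x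

  state : ∀ xs → ∃[ A ] ∃[ E ] State 0# L (length xs) A E
  state []       = _ , _ , start-state 0# L
  state (x ∷ xs) =
    let y , y∈ = clamp x
        _ , _ , s = state xs
        _ , _ , _ , s′ = insertion y y∈ s
    in  _ , _ , s′

  main : List ℝ → Array (size L)
  main xs = proj₁ (state xs)

  extras : List ℝ → List (Array (pow2 L))
  extras xs = proj₁ (proj₂ (state xs))

  change : ∀ xs x →
    Change (proj₁ (clamp x)) (main xs) (main (x ∷ xs)) (extras xs) (extras (x ∷ xs))
  change xs x =
    let y , y∈ = clamp x
        _ , _ , s = state xs
        _ , _ , c , _ = insertion y y∈ s
    in  c

  -- The leading `suc` and the final 1 are the sentinel cells around the root segment and the
  -- reserve.
  cells : ℕ
  cells = suc (size L ℕ.+ reserve ℕ.* pow2 L ℕ.+ 1)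

  array : List ℝ → Array cells
  array xs = just 0# ∷ ((main xs ++ pad reserve (extras xs)) ++ just 1# ∷ [])

  fill : ∀ xs x → length (extras (x ∷ xs)) ℕ.≤ reserve →
    Fill (proj₁ (clamp x)) (array xs) (array (x ∷ xs))
  fill xs x le = there (fill-++ˡ (fill-change (change xs x) le))

  -- The decision is an argument so that `runs` can substitute its outcome. The `zero` is a dummy:
  -- `extras≤reserve` excludes that case for up to `n` arrivals.
  cell : ∀ xs x → Dec (length (extras (x ∷ xs)) ℕ.≤ reserve) → Fin cells
  cell xs x (yes le) = index (fill xs x le)
  cell xs x (no _)   = zero

  algorithm : Algorithm cells
  algorithm xs x = cell xs x (length (extras (x ∷ xs)) ℕₚ.≤? reserve)

  extras≤reserve : ∀ xs → length xs ℕ.≤ n → length (extras xs) ℕ.≤ reserve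
  extras≤reserve xs le = subst (ℕ._≤ reserve) (m*n/n≡m _ (pow2 L))
    (/-monoˡ-≤ (pow2 L) (ℕₚ.≤-trans
      (subst (ℕ._≤ length xs) (ℕₚ.*-comm (pow2 L) _) (extra-bound (proj₂ (proj₂ (state xs))))) le))

  tabulate-initial : ∀ k → tabulate {n = k ℕ.+ 1}
    (λ i → if does (suc (toℕ i) ℕₚ.≟ (k ℕ.+ 1)) then just 1# else nothing)
    ≡ free k ++ just 1# ∷ []
  tabulate-initial zero    = refl
  tabulate-initial (suc k) = cong₂ _∷_ (nothing-first k) (tabulate-initial k)
    where
    nothing-first : ∀ k → (if does (0 ℕₚ.≟ (k ℕ.+ 1)) then just 1# else nothing) ≡ nothing
    nothing-first zero    = refl
    nothing-first (suc _) = refl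

  initial≡array : initial cells ≡ array []
  initial≡array = cong (just 0# ∷_) (trans (tabulate-initial (size L ℕ.+ reserve ℕ.* pow2 L))
    (cong (_++ just 1# ∷ []) (trans (replicate-++ (size L) (reserve ℕ.* pow2 L) nothing)
      (cong (free (size L) ++_) (sym (pad-[] {pow2 L} reserve))))))

  -- Invariant: the array reached is the one read off from the state, so the chosen cell is the
  -- empty one of `fill`. On [0, 1] `clamp` changes nothing, so the stored element is the arriving
  -- one.
  runs : ∀ xs → length xs ℕ.≤ n → All InUnitInterval xs → algorithm ⊢ xs ⇓ array xs
  runs []       _  _          = subst (algorithm ⊢ [] ⇓_) initial≡array start
  runs (x ∷ xs) le (x∈ ∷ xs∈) with length (extras (x ∷ xs)) ℕₚ.≤? reserve in eq
  ... | no ¬fits  = contradiction (extras≤reserve (x ∷ xs) le) ¬fits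
  ... | yes fits  = subst (algorithm ⊢ x ∷ xs ⇓_) updated
      (insert x (runs xs (ℕₚ.<⇒≤ le) xs∈)
        (trans (cong (lookup (array xs)) chosen) (index-empty (fill xs x fits))))
    where
    chosen : algorithm xs x ≡ index (fill xs x fits)
    chosen = cong (cell xs x) eq
    updated : array xs [ algorithm xs x ]≔ just x ≡ array (x ∷ xs)
    updated = sym (trans (index-update (fill xs x fits))
      (cong₂ (λ i y → array xs [ i ]≔ just y) (sym chosen) (clamp-id x∈)))

  cost-bound : ∀ xs → length xs ℕ.≤ n →
    cost (array xs) ≤ fromℕ (pow2 L ℕ.+ 2 ℕ.* (suc L ℕ.* n)) / fromℕ (pow2 L)
  cost-bound xs le = begin
    cost (array xs)                             ≡⟨ variation-pathCost 0# (A ++ pad reserve E) 1# ⟩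
    -- With waypoint 1 the root segment is a path from 0 to 1 and the reserve a loop at 1, as in
    -- `stateCost`.
    pathCost 0# (A ++ pad reserve E) 1#         ≤⟨ pathCost-++ 0# A (pad reserve E) 1# 1# ⟩
    pathCost 0# A 1# + loop 1# (pad reserve E)  ≤⟨ +-monoʳ-≤ _ (loops-pad 1# reserve E (extras≤reserve xs le)) ⟩
    pathCost 0# A 1# + loops 1# E               ≡⟨ cong (λ b → pathCost 0# A b + loops b E) 0+width≡1 ⟨
    stateCost s                                 ≤⟨ stateCost-bound s ⟩
    units (pow2 L ℕ.+ 2 ℕ.* (suc L ℕ.* length xs))
      ≤⟨ units-mono-≤ (ℕₚ.+-monoʳ-≤ (pow2 L) (ℕₚ.*-monoʳ-≤ 2 (ℕₚ.*-monoʳ-≤ (suc L) le))) ⟩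
    units (pow2 L ℕ.+ 2 ℕ.* (suc L ℕ.* n))      ∎
    where
    A = main xs
    E = extras xs
    s = proj₂ (proj₂ (state xs))

  sorts : SortsWithCost algorithm n (fromℕ (pow2 L ℕ.+ 2 ℕ.* (suc L ℕ.* n)) / fromℕ (pow2 L))
  sorts xs refl xs∈ = array xs , runs xs le xs∈ , cost-bound xs le
    where
    le : length xs ℕ.≤ 2 ℕ.+ length xs
    le = ℕₚ.m≤n+m (length xs) 2

  -- The reserve falls short of `n` by less than `pow2 L`, and the root segment has at least that
  -- many cells.
  n≤cells : n ℕ.≤ cells
  n≤cells = N.begin
    n                                        N.≡⟨ m≡m%n+[m/n]*n n (pow2 L) ⟩
    n ℕ.% pow2 L ℕ.+ reserve ℕ.* pow2 L      N.≤⟨ ℕₚ.+-monoˡ-≤ _ (ℕₚ.<⇒≤ (m%n<n n (pow2 L))) ⟩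
    pow2 L ℕ.+ reserve ℕ.* pow2 L            N.≤⟨ ℕₚ.+-monoˡ-≤ _ pow2≤size ⟩
    size L ℕ.+ reserve ℕ.* pow2 L            N.≤⟨ ℕₚ.m≤n⇒m≤1+n (ℕₚ.m≤m+n _ 1) ⟩
    cells                                    N.∎
    where
    module N = ℕₚ.≤-Reasoning
    pow2≤size : pow2 L ℕ.≤ size L
    pow2≤size = subst (pow2 L ℕ.≤_) (sym (size≡ L)) (ℕₚ.m≤m+n (pow2 L) (L ℕ.* pow2 L))

  -- One `n` absorbs the two sentinel cells, the other the reserve.
  cells-bound : 2 ℕ.≤ n → cells ℕ.≤ 2 ℕ.* n ℕ.+ suc L ℕ.* pow2 L
  cells-bound 2≤n = N.begin
    cells                                             N.≡⟨ cong (λ s → suc (s ℕ.+ reserve ℕ.* pow2 L ℕ.+ 1)) (size≡ L) ⟩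
    suc (suc L ℕ.* pow2 L ℕ.+ reserve ℕ.* pow2 L ℕ.+ 1) N.≡⟨ eq _ (reserve ℕ.* pow2 L) ⟩
    2 ℕ.+ reserve ℕ.* pow2 L ℕ.+ suc L ℕ.* pow2 L
      N.≤⟨ ℕₚ.+-monoˡ-≤ _ (ℕₚ.+-mono-≤ 2≤n (m/n*n≤m n (pow2 L))) ⟩
    n ℕ.+ n ℕ.+ suc L ℕ.* pow2 L                      N.≡⟨ cong (λ m → n ℕ.+ m ℕ.+ suc L ℕ.* pow2 L) (ℕₚ.+-identityʳ n) ⟨
    2 ℕ.* n ℕ.+ suc L ℕ.* pow2 L                      N.∎
    where
    module N = ℕₚ.≤-Reasoning
    eq : ∀ a b → suc (a ℕ.+ b ℕ.+ 1) ≡ 2 ℕ.+ b ℕ.+ a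
    eq = solve-∀

-- Integer logarithm and the search for the depth.

pow2-+ : ∀ j k → pow2 (j ℕ.+ k) ≡ pow2 j ℕ.* pow2 k
pow2-+ zero    k = sym (ℕₚ.*-identityˡ (pow2 k))
pow2-+ (suc j) k = trans (cong₂ ℕ._+_ (pow2-+ j k) (pow2-+ j k))
  (sym (ℕₚ.*-distribʳ-+ (pow2 k) (pow2 j) (pow2 j)))

n<pow2 : ∀ n → n ℕ.< pow2 n
n<pow2 zero    = s≤s z≤n
n<pow2 (suc n) = ℕₚ.+-mono-≤ (1≤pow2 n) (n<pow2 n)

floor-log : ∀ n → 2 ℕ.≤ n → ∃[ k ] 1 ℕ.≤ k × pow2 k ℕ.≤ n × n ℕ.< pow2 (suc k)
floor-log 1 (s≤s ())
floor-log 2 _ = 1 , s≤s z≤n , ℕₚ.≤-refl , s≤s (s≤s (s≤s z≤n))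
floor-log (suc n@(suc (suc _))) _ with floor-log n (s≤s (s≤s z≤n))
... | k , 1≤k , lo , hi with pow2 (suc k) ℕₚ.≤? suc n
...   | no  gt = k , 1≤k , ℕₚ.m≤n⇒m≤1+n lo , ℕₚ.≰⇒> gt
...   | yes le = suc k , s≤s z≤n , le , ℕₚ.≤-<-trans hi
          (ℕₚ.m<m+n (pow2 (suc k)) (1≤pow2 (suc k)))

-- Selects the depth: the first outcome reaches the cap, the second comes with a failure at the next
-- depth, which later bounds γ n from above.
last-before : ∀ {P : ℕ → Set} → (∀ j → Dec (P j)) → P 0 → ∀ j →
  P j ⊎ ∃[ i ] i ℕ.< j × P i × ¬ P (suc i)
last-before P? p zero    = inj₁ p
last-before P? p (suc j) with last-before P? p j
... | inj₂ (i , i<j , q) = inj₂ (i , ℕₚ.m≤n⇒m≤1+n i<j , q)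
... | inj₁ pj with P? (suc j)
...   | yes q = inj₁ q
...   | no ¬q = inj₂ (j , ℕₚ.≤-refl , pj , ¬q)

-- Trade-off between array size and cost.

module Tradeoff (R : Reals) where
  open Reals R
  open Logarithm R
  open OnlineSorting R
  open OrderedField R
  open OrderedField.≤-Reasoning R

  -- The integer `k` is the member of the cut with numerator `k` and denominator 1.
  fromℕ≤log₂ : ∀ n k → 1 ℕ.≤ n → pow2 k ℕ.≤ n → fromℕ k ≤ log₂ n
  fromℕ≤log₂ n@(suc _) k _ le = subst (_≤ log₂ n) eq
    (proj₁ (proj₂ (log₂-supremum n)) (fromℕ k / fromℕ 1)
      (k , 0 , subst₂ ℕ._≤_ (pow2≡2^ k) (sym (ℕₚ.*-identityʳ n)) le , refl))
    where
    eq : fromℕ k / fromℕ 1 ≡ fromℕ k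
    eq = trans (sym (*-identityʳ _)) (trans (cong (fromℕ k / fromℕ 1 *_) (sym fromℕ-1))
      (/-cancel (fromℕ k) (0<fromℕ 1)))

  onlineSortable-≤ : ∀ {n s c d} → c ≤ d → OnlineSortable n s c → OnlineSortable n s d
  onlineSortable-≤ c≤d (m , n≤m , m≤s , A , sorts) = m , n≤m , m≤s , A , λ xs eq xs∈ →
    let a , runs , c≤ = sorts xs eq xs∈ in a , runs , ≤-trans c≤ c≤d

  need : ℕ → ℕ → ℕ
  need n L = 2 ℕ.* n ℕ.+ suc L ℕ.* pow2 L

  -- The cost bound at depth `L`, counted in units of 2^-L.
  price : ℕ → ℕ → ℕ
  price n L = pow2 L ℕ.+ 2 ℕ.* (suc L ℕ.* n)

  sortable : ∀ n L {s d} → 2 ℕ.≤ n → fromℕ (need n L) ≤ s → fromℕ (price n L) ≤ d * fromℕ (pow2 L) →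
    OnlineSortable n s d
  sortable n L {d = d} 2≤n space time =
    cells , n≤cells , ≤-trans (fromℕ-mono-≤ (cells-bound 2≤n)) space , algorithm , λ xs eq xs∈ →
    let a , runs , c≤ = sorts xs eq xs∈ in a , runs , ≤-trans c≤ price≤
    where
    open Sorter R L n
    0<P : 0# < fromℕ (pow2 L)
    0<P = 0<fromℕ (pow2 L) {{pow2-nonZero L}}
    price≤ : fromℕ (price n L) / fromℕ (pow2 L) ≤ d
    price≤ = *-cancelʳ-≤ 0<P (subst (_≤ d * fromℕ (pow2 L)) (sym (/-cancel _ 0<P)) time)

  -- With p = 2^k, both n and 2k + 1 are at most 2p, so the detours take at most 8p² units and the
  -- straight walk takes p². Depth 2k thus costs at most 9.
  price-deep : ∀ n k → n ℕ.≤ pow2 (suc k) → price n (k ℕ.+ k) ℕ.≤ 9 ℕ.* pow2 (k ℕ.+ k)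
  price-deep n k n≤ = N.begin
    pow2 (k ℕ.+ k) ℕ.+ 2 ℕ.* (suc (k ℕ.+ k) ℕ.* n)
      N.≤⟨ ℕₚ.+-monoʳ-≤ (pow2 (k ℕ.+ k)) (ℕₚ.*-monoʳ-≤ 2 (ℕₚ.*-mono-≤ depth n≤)) ⟩
    pow2 (k ℕ.+ k) ℕ.+ 2 ℕ.* ((p ℕ.+ p) ℕ.* (p ℕ.+ p))
      N.≡⟨ cong (ℕ._+ 2 ℕ.* ((p ℕ.+ p) ℕ.* (p ℕ.+ p))) (pow2-+ k k) ⟩
    p ℕ.* p ℕ.+ 2 ℕ.* ((p ℕ.+ p) ℕ.* (p ℕ.+ p))
      N.≡⟨ eq p ⟩
    9 ℕ.* (p ℕ.* p)
      N.≡⟨ cong (9 ℕ.*_) (pow2-+ k k) ⟨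
    9 ℕ.* pow2 (k ℕ.+ k)  N.∎
    where
    module N = ℕₚ.≤-Reasoning
    p = pow2 k
    depth : suc (k ℕ.+ k) ℕ.≤ p ℕ.+ p
    depth = ℕₚ.+-mono-≤ (n<pow2 k) (ℕₚ.<⇒≤ (n<pow2 k))
    eq : ∀ p → p ℕ.* p ℕ.+ 2 ℕ.* ((p ℕ.+ p) ℕ.* (p ℕ.+ p)) ≡ 9 ℕ.* (p ℕ.* p)
    eq = solve-∀

  -- From L + 1 ≤ 2k and 1 ≤ k follows L + 2 ≤ 3k, and 2 · 2k · 4 · 3k = 48k².
  depth-bound : ∀ L k → suc L ℕ.≤ k ℕ.+ k → 1 ℕ.≤ k →
    2 ℕ.* suc L ℕ.* (4 ℕ.* suc (suc L)) ℕ.≤ 48 ℕ.* (k ℕ.* k)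
  depth-bound L k L<2k 1≤k = N.begin
    2 ℕ.* suc L ℕ.* (4 ℕ.* suc (suc L))
      N.≤⟨ ℕₚ.*-mono-≤ (ℕₚ.*-monoʳ-≤ 2 L<2k) (ℕₚ.*-monoʳ-≤ 4 (ℕₚ.+-mono-≤ 1≤k L<2k)) ⟩
    2 ℕ.* (k ℕ.+ k) ℕ.* (4 ℕ.* (k ℕ.+ (k ℕ.+ k))) N.≡⟨ eq k ⟩
    48 ℕ.* (k ℕ.* k) N.∎
    where
    module N = ℕₚ.≤-Reasoning
    eq : ∀ k → 2 ℕ.* (k ℕ.+ k) ℕ.* (4 ℕ.* (k ℕ.+ (k ℕ.+ k))) ≡ 48 ℕ.* (k ℕ.* k)
    eq = solve-∀

  -- Maximality of the depth: the array of the next depth exceeds γ n cells,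
  -- and 2 n ≤ γ n / 2.
  density-bound : ∀ {γ} n L → fromℕ 4 ≤ γ → ¬ fromℕ (need n (suc L)) ≤ γ * fromℕ n →
    γ * fromℕ n ≤ fromℕ (4 ℕ.* suc (suc L) ℕ.* pow2 L)
  density-bound {γ} n L 4≤γ ¬fits with ≤-total (γ * fromℕ n) (fromℕ (need n (suc L)))
  ... | inj₂ fits = contradiction fits ¬fits
  ... | inj₁ γn≤  = +-cancelʳ-≤ (γ * fromℕ n) (begin
    γ * fromℕ n + γ * fromℕ n                               ≤⟨ +-mono-≤ γn≤ γn≤ ⟩
    fromℕ (need n (suc L)) + fromℕ (need n (suc L))         ≡⟨ fromℕ-+ (need n (suc L)) _ ⟨
    fromℕ (need n (suc L) ℕ.+ need n (suc L))               ≡⟨ cong fromℕ (eq n L (pow2 L)) ⟩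
    fromℕ (4 ℕ.* suc (suc L) ℕ.* pow2 L ℕ.+ 4 ℕ.* n)        ≡⟨ fromℕ-+ (4 ℕ.* suc (suc L) ℕ.* pow2 L) _ ⟩
    fromℕ (4 ℕ.* suc (suc L) ℕ.* pow2 L) + fromℕ (4 ℕ.* n)
      ≤⟨ +-monoʳ-≤ _ (subst (_≤ γ * fromℕ n) (sym (fromℕ-* 4 n)) (*-monoˡ-≤ (0≤fromℕ n) 4≤γ)) ⟩
    fromℕ (4 ℕ.* suc (suc L) ℕ.* pow2 L) + γ * fromℕ n      ∎)
    where
    eq : ∀ n L p →
      (2 ℕ.* n ℕ.+ suc (suc L) ℕ.* (p ℕ.+ p)) ℕ.+ (2 ℕ.* n ℕ.+ suc (suc L) ℕ.* (p ℕ.+ p))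
      ≡ 4 ℕ.* suc (suc L) ℕ.* p ℕ.+ 4 ℕ.* n
    eq = solve-∀

  -- After multiplication by γ the detour term contains γ n, which `density-bound` replaces by a
  -- multiple of 2^L. The cost is thus at most 1 + 8 (L + 1)(L + 2) / γ.
  price-shallow : ∀ {γ} n L → fromℕ 4 ≤ γ → ¬ fromℕ (need n (suc L)) ≤ γ * fromℕ n →
    fromℕ (price n L) * γ ≤ (γ + fromℕ (2 ℕ.* suc L ℕ.* (4 ℕ.* suc (suc L)))) * fromℕ (pow2 L)
  price-shallow {γ} n L 4≤γ ¬fits = begin
    fromℕ (p ℕ.+ 2 ℕ.* (suc L ℕ.* n)) * γ
      ≡⟨ cong (λ m → fromℕ (p ℕ.+ m) * γ) (ℕₚ.*-assoc 2 (suc L) n) ⟨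
    fromℕ (p ℕ.+ b ℕ.* n) * γ                     ≡⟨ cong (_* γ) (fromℕ-+ p (b ℕ.* n)) ⟩
    (fromℕ p + fromℕ (b ℕ.* n)) * γ               ≡⟨ distribʳ γ (fromℕ p) _ ⟩
    fromℕ p * γ + fromℕ (b ℕ.* n) * γ
      ≡⟨ cong₂ _+_ (*-comm (fromℕ p) γ) (trans (cong (_* γ) (fromℕ-* b n)) (trans (*-assoc _ _ γ)
           (cong (fromℕ b *_) (*-comm (fromℕ n) γ)))) ⟩
    γ * fromℕ p + fromℕ b * (γ * fromℕ n)
      ≤⟨ +-monoʳ-≤ _ (*-monoʳ-≤ (0≤fromℕ b) (density-bound n L 4≤γ ¬fits)) ⟩
    γ * fromℕ p + fromℕ b * fromℕ (c ℕ.* p)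
      ≡⟨ cong (γ * fromℕ p +_) (trans (cong (fromℕ b *_) (fromℕ-* c p)) (trans (sym (*-assoc _ _ _))
           (cong (_* fromℕ p) (sym (fromℕ-* b c))))) ⟩
    γ * fromℕ p + fromℕ (b ℕ.* c) * fromℕ p       ≡⟨ distribʳ (fromℕ p) γ _ ⟨
    (γ + fromℕ (b ℕ.* c)) * fromℕ p               ∎
    where
    p = pow2 L
    b = 2 ℕ.* suc L
    c = 4 ℕ.* suc (suc L)

  1≤log₂ : ∀ n → 2 ℕ.≤ n → 1# ≤ log₂ n
  1≤log₂ n 2≤n = subst (_≤ log₂ n) fromℕ-1 (fromℕ≤log₂ n 1 (ℕₚ.<⇒≤ 2≤n) 2≤n)

  1≤log₂² : ∀ n → 2 ℕ.≤ n → 1# ≤ log₂² n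
  1≤log₂² n 2≤n = subst (_≤ log₂² n) (*-identityˡ 1#)
    (*-mono-≤ 0≤1 (1≤x⇒0≤x (1≤log₂ n 2≤n)) (1≤log₂ n 2≤n) (1≤log₂ n 2≤n))

  -- The 9 comes from `price-deep`, the 48 from `depth-bound`; `C` enters through γ ≤ C log² n.
  factor : ℝ → ℝ
  factor C = fromℕ 9 * C + fromℕ 48

  1≤factor : ∀ {C} → 0# ≤ C → 1# ≤ factor C
  1≤factor 0≤C = ≤-trans (1≤fromℕ 48) (subst (fromℕ 48 ≤_) (+-comm _ _)
    (x≤x+y (*-nonNegative (0≤fromℕ 9) 0≤C)))

  module LargeArray (C : ℝ) (n : ℕ) (2≤n : 2 ℕ.≤ n)
                    (γ : ℝ) (4≤γ : fromℕ 4 ≤ γ) (γ≤ : γ ≤ C * log₂² n) where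
    ℓ² : ℝ
    ℓ² = log₂² n

    1≤γ : 1# ≤ γ
    1≤γ = ≤-trans (1≤fromℕ 4) 4≤γ

    0<γ : 0# < γ
    0<γ = 1≤x⇒0<x 1≤γ

    0≤γ : 0# ≤ γ
    0≤γ = proj₁ 0<γ

    price-suffices : ∀ L {b} → fromℕ (price n L) * γ ≤ b * fromℕ (pow2 L) → b ≤ factor C * ℓ² →
      fromℕ (price n L) ≤ factor C * (ℓ² / γ) * fromℕ (pow2 L)
    price-suffices L {b} le b≤ = *-cancelʳ-≤ 0<γ (begin
      fromℕ (price n L) * γ                    ≤⟨ le ⟩
      b * P                                    ≤⟨ *-monoˡ-≤ (0≤fromℕ (pow2 L)) b≤ ⟩
      factor C * ℓ² * P                        ≡⟨ cong (λ x → factor C * x * P) (/-cancel ℓ² 0<γ) ⟨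
      factor C * (ℓ² / γ * γ) * P              ≡⟨ cong (_* P) (*-assoc (factor C) _ γ) ⟨
      factor C * (ℓ² / γ) * γ * P              ≡⟨ *-assoc _ γ P ⟩
      factor C * (ℓ² / γ) * (γ * P)            ≡⟨ cong (factor C * (ℓ² / γ) *_) (*-comm γ P) ⟩
      factor C * (ℓ² / γ) * (P * γ)            ≡⟨ *-assoc _ P γ ⟨
      factor C * (ℓ² / γ) * P * γ              ∎)
      where P = fromℕ (pow2 L)

    0≤ℓ² : 0# ≤ ℓ²
    0≤ℓ² = 0≤x² (log₂ n)

    9γ≤ : fromℕ 9 * γ ≤ factor C * ℓ²
    9γ≤ = begin
      fromℕ 9 * γ                   ≤⟨ *-monoʳ-≤ (0≤fromℕ 9) γ≤ ⟩
      fromℕ 9 * (C * ℓ²)            ≡⟨ *-assoc _ C ℓ² ⟨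
      fromℕ 9 * C * ℓ²              ≤⟨ *-monoˡ-≤ 0≤ℓ² (x≤x+y (0≤fromℕ 48)) ⟩
      factor C * ℓ²                 ∎

    γ+48k²≤ : ∀ {k} → fromℕ k ≤ log₂ n → γ + fromℕ (48 ℕ.* (k ℕ.* k)) ≤ factor C * ℓ²
    γ+48k²≤ {k} k≤ = begin
      γ + fromℕ (48 ℕ.* (k ℕ.* k))
        ≡⟨ cong (γ +_) (trans (fromℕ-* 48 (k ℕ.* k)) (cong (fromℕ 48 *_) (fromℕ-* k k))) ⟩
      γ + fromℕ 48 * (fromℕ k * fromℕ k)
        ≤⟨ +-mono-≤ γ≤9γ (*-monoʳ-≤ (0≤fromℕ 48)
             (*-mono-≤ (0≤fromℕ k) (1≤x⇒0≤x (1≤log₂ n 2≤n)) k≤ k≤)) ⟩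
      fromℕ 9 * γ + fromℕ 48 * ℓ²
        ≤⟨ +-monoˡ-≤ _ (subst (fromℕ 9 * γ ≤_) (sym (*-assoc _ C ℓ²)) (*-monoʳ-≤ (0≤fromℕ 9) γ≤)) ⟩
      fromℕ 9 * C * ℓ² + fromℕ 48 * ℓ²          ≡⟨ distribʳ ℓ² _ _ ⟨
      factor C * ℓ²                             ∎
      where
      γ≤9γ : γ ≤ fromℕ 9 * γ
      γ≤9γ = subst (_≤ fromℕ 9 * γ) (*-identityˡ γ) (*-monoˡ-≤ 0≤γ (1≤fromℕ 9))

    fits-0 : fromℕ (need n 0) ≤ γ * fromℕ n
    fits-0 = begin
      fromℕ (2 ℕ.* n ℕ.+ 1)      ≤⟨ fromℕ-mono-≤ (ℕₚ.+-monoʳ-≤ (2 ℕ.* n) (ℕₚ.≤-trans (ℕₚ.<⇒≤ 2≤n) (ℕₚ.m≤m+n n (n ℕ.+ 0)))) ⟩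
      fromℕ (2 ℕ.* n ℕ.+ 2 ℕ.* n) ≡⟨ cong fromℕ (ℕₚ.*-distribʳ-+ n 2 2) ⟨
      fromℕ (4 ℕ.* n)            ≡⟨ fromℕ-* 4 n ⟩
      fromℕ 4 * fromℕ n          ≤⟨ *-monoˡ-≤ (0≤fromℕ n) 4≤γ ⟩
      γ * fromℕ n                ∎

    tradeoff : OnlineSortable n (γ * fromℕ n) (factor C * (ℓ² / γ))
    tradeoff with floor-log n 2≤n
    ... | k , 1≤k , lo , hi with last-before (λ L → fromℕ (need n L) ≤? γ * fromℕ n) fits-0 (k ℕ.+ k)
    -- The cap 2k is reached: the cost is at most 9, and 9 ≤ 9 C log² n / γ by the upper bound on γ.
    ...   | inj₁ fits = sortable n (k ℕ.+ k) 2≤n fits (price-suffices (k ℕ.+ k) deep 9γ≤)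
            where
            P = fromℕ (pow2 (k ℕ.+ k))
            deep : fromℕ (price n (k ℕ.+ k)) * γ ≤ fromℕ 9 * γ * P
            deep = begin
              fromℕ (price n (k ℕ.+ k)) * γ
                ≤⟨ *-monoˡ-≤ 0≤γ (fromℕ-mono-≤ (price-deep n k (ℕₚ.<⇒≤ hi))) ⟩
              fromℕ (9 ℕ.* pow2 (k ℕ.+ k)) * γ   ≡⟨ cong (_* γ) (fromℕ-* 9 (pow2 (k ℕ.+ k))) ⟩
              fromℕ 9 * P * γ                    ≡⟨ *-assoc _ P γ ⟩
              fromℕ 9 * (P * γ)                  ≡⟨ cong (fromℕ 9 *_) (*-comm P γ) ⟩
              fromℕ 9 * (γ * P)                  ≡⟨ *-assoc _ γ P ⟨
              fromℕ 9 * γ * P                    ∎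
    -- The array size stops the search below 2k; k ≤ log n turns the term of order L² / γ into one
    -- of order log² n / γ.
    ...   | inj₂ (L , L<2k , fits , ¬fits) = sortable n L 2≤n fits
            (price-suffices L (price-shallow n L 4≤γ ¬fits)
              (≤-trans (+-monoʳ-≤ γ (fromℕ-mono-≤ (depth-bound L k L<2k 1≤k)))
                (γ+48k²≤ {k} (fromℕ≤log₂ n k (ℕₚ.<⇒≤ 2≤n) lo))))

  -- Take γ = 4 log² n, the upper end of the range for `C` = 4. It is at least 4 because log n ≥ 1,
  -- and log² n / γ ≤ 1.
  log-squared-space : ∀ n → 2 ℕ.≤ n →
    OnlineSortable n (fromℕ 4 * (fromℕ n * log₂² n)) (factor (fromℕ 4))
  log-squared-space n 2≤n = subst (λ s → OnlineSortable n s (factor C)) eq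
    (onlineSortable-≤ cost≤ (LargeArray.tradeoff C n 2≤n γ 4≤γ ≤-refl))
    where
    C = fromℕ 4
    0≤C = 0≤fromℕ 4
    ℓ² = log₂² n
    γ = C * ℓ²
    4≤γ : C ≤ γ
    4≤γ = subst (_≤ γ) (*-identityʳ C) (*-monoʳ-≤ 0≤C (1≤log₂² n 2≤n))
    0<γ : 0# < γ
    0<γ = 1≤x⇒0<x (≤-trans (1≤fromℕ 4) 4≤γ)
    ℓ²/γ≤1 : ℓ² / γ ≤ 1#
    ℓ²/γ≤1 = *-cancelʳ-≤ 0<γ (subst₂ _≤_ (trans (*-identityˡ ℓ²) (sym (/-cancel ℓ² 0<γ)))
      (sym (*-identityˡ γ)) (*-monoˡ-≤ (0≤x² (log₂ n)) (1≤fromℕ 4)))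
    cost≤ : factor C * (ℓ² / γ) ≤ factor C
    cost≤ = subst (factor C * (ℓ² / γ) ≤_) (*-identityʳ _)
      (*-monoʳ-≤ (1≤x⇒0≤x (1≤factor 0≤C)) ℓ²/γ≤1)
    eq : γ * fromℕ n ≡ C * (fromℕ n * ℓ²)
    eq = trans (*-assoc C ℓ² _) (cong (C *_) (*-comm ℓ² _))

mainTheorem2 : (R : Reals) →
    let open Reals R
        open Logarithm R
        open OnlineSorting R
    in
    (∃[ γ₀ ] 1# ≤ γ₀ ×
      (∀ C → 0# < C →
        ∃[ K ] 0# < K ×
          (∀ n → 2 ℕ.≤ n →
           ∀ γ → γ₀ ≤ γ → γ ≤ C * log₂² n →
           OnlineSortable n (γ * fromℕ n) (K * (log₂² n / γ)))))
    ×
    (∃[ S ] ∃[ B ] 0# < S × 0# < B ×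
      (∀ n → 2 ℕ.≤ n →
       OnlineSortable n (S * (fromℕ n * log₂² n)) B))
mainTheorem2 R =
  -- With γ ≥ 4 the 2 n cells in `need` are at most half of γ n, as used in `density-bound`, and
  -- depth 0 always fits.
  (fromℕ 4 , 1≤fromℕ 4 , λ C 0<C →
    factor C , 1≤x⇒0<x (1≤factor (proj₁ 0<C)) , LargeArray.tradeoff C) ,
  (fromℕ 4 , factor (fromℕ 4) , 0<fromℕ 4 , 1≤x⇒0<x (1≤factor (0≤fromℕ 4)) ,
    log-squared-space)
  where
  open Reals R
  open OrderedField R
  open Tradeoff R
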